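{- Let $p$ be a prime, and let $a,l,n\in\mathbb N$ and $r\in\mathbb Z$. Then $$\sum_{k=0}^n\binom nk(-1)^kF_p\bigl(kp^a(p-1)+l,\,r\bigr)\equiv 0\pmod{p^{\,an+\lceil(n-l^*)/(p-1)\rceil}},$$ where $l^*=\{ -l\}_{p-1}$.
   Context: $\mathbb N=\{0,1,2,\ldots\}$. For $a\in\mathbb Z$ and a positive integer $m$, $\{a\}_m$ denotes the least nonnegative residue of $a$ modulo $m$. $\lceil\cdot\rceil$ is the ceiling function. For a prime $p$, $n\in\mathbb N$ and $r\in\mathbb Z$, put $C_p(n,r)=\sum_{0\le k\le n,\ k\equiv r\,(\mathrm{mod}\ p)}\binom nk(-1)^k$. The Fleck quotient is $$F_p(n,r)=(-p)^{ -\lfloor(n-1)/(p-1)\rfloor}C_p(n,r)+[\![n=0]\!],$$ where $[\![A]\!]$ is $1$ if the assertion $A$ holds and $0$ otherwise; it is an integer (Fleck). -}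

module Defs where

open import Algebra.Definitions.RawSemiring using (_^_)
open import Data.Bool.Base using (if_then_else_)
open import Data.Integer.Base as ℤ using (ℤ; +_; -[1+_]; -1ℤ; 0ℤ; 1ℤ)
open import Data.Integer.Divisibility.Signed using (_∣?_)
open import Data.List.Base using (foldr; map; filter; upTo)
open import Data.Nat.Base as ℕ using (ℕ; suc; _∸_)
open import Data.Nat.Combinatorics using (_C_)
open import Data.Nat.Primality using (Prime; prime⇒nonTrivial; prime⇒nonZero)
open import Data.Nat.Properties using (_≟_; m<n⇒0<n∸m)
open import Data.Product.Base using (∃)
open import Data.Rational.Base as ℚ using (ℚ; 0ℚ; 1ℚ; 1/_; _/_; floor; +-*-rawSemiring)
open import Data.Rational.Properties using (neg-pos; neg⇒nonZero; normalize-pos; pos⇒nonZero)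
open import Relation.Binary.PropositionalEquality.Core using (_≡_)
open import Relation.Nullary.Decidable.Core using (Dec; does)

ι : ℤ → ℚ
ι i = i / 1

ι-nonZero : ∀ i .{{_ : ℤ.NonZero i}} → ℚ.NonZero (ι i)
ι-nonZero ℤ.+[1+ n ] = pos⇒nonZero (ι ℤ.+[1+ n ]) {{normalize-pos (suc n) 1}}
ι-nonZero -[1+ n ]   =
  neg⇒nonZero (ι -[1+ n ]) {{neg-pos {ι ℤ.+[1+ n ]} (normalize-pos (suc n) 1)}}

infixr 8 _^ᶻ_
_^ᶻ_ : (b : ℤ) .{{_ : ℤ.NonZero b}} → ℤ → ℚ
b ^ᶻ (+ k)    = ι (b ℤ.^ k)
b ^ᶻ -[1+ k ] = _^_ +-*-rawSemiring (1/_ (ι b) {{ι-nonZero b}}) (suc k)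

infix 5 sum-upTo
sum-upTo : ℕ → (ℕ → ℚ) → ℚ
sum-upTo n f = foldr ℚ._+_ 0ℚ (map f (upTo (suc n)))

syntax sum-upTo n (λ k → t) = Σ[ k ≤ n ] t

⟦_⟧ : {A : Set} → Dec A → ℚ
⟦ A? ⟧ = if does A? then 1ℚ else 0ℚ

-- The congruence is stated in ℚ with an integer cofactor, so when the modulus
-- is an integer, x ≡ 0 ⟨mod m ⟩ also asserts that x is an integer.
infix 4 _≡_⟨mod_⟩
_≡_⟨mod_⟩ : ℚ → ℚ → ℚ → Set
x ≡ y ⟨mod m ⟩ = ∃ λ (z : ℤ) → x ℚ.- y ≡ m ℚ.* ι z

neg-nonZero : ∀ n .{{_ : ℕ.NonZero n}} → ℤ.NonZero (ℤ.- (+ n))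
neg-nonZero (suc _) = _

instance
  prime⇒nonZero[p∸1] : ∀ {p} {{_ : Prime p}} → ℕ.NonZero (p ∸ 1)
  prime⇒nonZero[p∸1] {p} {{p-prime}} =
    ℕ.>-nonZero (m<n⇒0<n∸m (ℕ.nonTrivial⇒n>1 p {{prime⇒nonTrivial p-prime}}))

C[_] : ℕ → ℕ → ℤ → ℤ
C[ p ] n r = foldr ℤ._+_ 0ℤ
  (map (λ k → + (n C k) ℤ.* -1ℤ ℤ.^ k)
       (filter (λ k → + p ∣? + k ℤ.- r) (upTo (suc n))))

-- The value is a priori only rational.  The floor is taken of a rational number,
-- so for n = 0 the exponent of -p is 1.
F[_] : (p : ℕ) {{_ : Prime p}} → ℕ → ℤ → ℚ
F[ p ] {{p-prime}} n r =
  _^ᶻ_ (ℤ.- (+ p)) {{neg-nonZero p {{prime⇒nonZero p-prime}}}}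
       (ℤ.- ⌊ (+ n ℤ.- 1ℤ) / (p ∸ 1) ⌋)
    ℚ.* ι (C[ p ] n r)
    ℚ.+ ⟦ n ≟ 0 ⟧

{-# OPTIONS --safe #-}
module Submission where

-- With π = 1 - ζ in ℤ[ζ], ζ a primitive p-th root of unity, C_p(n,r) = Tr(ζ^(-r) π^n) / p for
-- n > 0, and π^(p-1) = -p u with u ≡ 1 (mod π).  Hence F_p(k p^a (p-1) + l, r) is a fixed
-- functional of u^(k p^a), and the alternating sum is that functional at (1 - u^(p^a))^n.
-- Since p^a π divides 1 - u^(p^a), the factor p^(an) splits off, and the remaining π^n
-- contributes the ceiling, as π^(p-1) ~ p.
-- Elements of ℤ[ζ] are represented by polynomials in the shift operator acting on the
-- functions ℤ → ℤ killed by 1 + X + … + X^(p-1); this replaces the trace.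

open import Algebra.Bundles using (CommutativeRing)
import Algebra.Definitions.RawSemiring as RawSemiring
import Algebra.Properties.Group as GroupProperties
open import Algebra.Structures using (IsCommutativeRing)
open import Data.Bool.Base using (if_then_else_; true; false)
open import Data.Integer.Base as ℤ using (ℤ; +_; -[1+_]; -1ℤ; 0ℤ; 1ℤ)
open import Data.Integer.DivMod using (_%ℕ_; _/ℕ_; n%ℕd<d; n%d<d; a≡a%ℕn+[a/ℕn]*n; a≡a%n+[a/n]*n)
open import Data.Integer.Divisibility.Signed as ℤ using (_∣?_)
import Data.Integer.GCD as ℤ
import Data.Integer.Properties as ℤ
open import Data.Integer.Tactic.RingSolver using (solve-∀)
open import Data.List.Base using (foldr; map; filter; applyUpTo)
open import Data.Nat.Base as ℕ using (ℕ; zero; suc; _∸_; z<s; s<s)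
open import Data.Nat.Combinatorics using (_C_; nC1≡n; nCk+nC[k+1]≡[n+1]C[k+1]; k>n⇒nCk≡0)
open import Data.Nat.Divisibility as ℕ using (_∣_; divides)
import Data.Nat.DivMod as ℕ
open import Data.Nat.Primality
  using (Prime; prime⇒nonZero; prime⇒nonTrivial; ¬prime[0]; euclidsLemma)
import Data.Nat.Properties as ℕ
import Data.Nat.Tactic.RingSolver as ℕSolver
open import Data.Product.Base using (∃; _,_; _×_)
open import Data.Rational.Base as ℚ using (ℚ; 0ℚ; 1ℚ; _/_; floor; ceiling; ↥_; ↧_; ↧ₙ_)
import Data.Rational.Properties as ℚ
open import Data.Rational.Unnormalised.Base as ℚᵘ using (mkℚᵘ; *≡*)
import Data.Rational.Unnormalised.Properties as ℚᵘ
open import Data.Sum.Base using (inj₁; inj₂)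
open import Defs
open import Function.Base using (_∘_; it)
open import Level using (0ℓ)
import Relation.Binary.Reasoning.Setoid as SetoidReasoning
open import Relation.Binary.PropositionalEquality
open import Relation.Binary.Structures using (IsEquivalence)
open import Relation.Nullary.Decidable using (does; dec-true; dec-false)
open import Relation.Nullary.Negation using (¬_; contradiction)
open import Relation.Unary using (Pred; Decidable)

-- Finite sums and alternating binomial sums

-- Raising to the power p sharpens the congruence V ≡ 1: 1 - V^p is 1 - V times 1 + V + ... +
-- V^(p-1), and the second factor is (1 - V)^(p-1) + p u(V) for every element V, not only for ζ. If
-- π divides 1 - V, both terms are multiples of p, since π^(p-1) is one; so each step gains a full p
-- while the single π is kept.
--
-- The shift l enters through q = ⌈l/(p-1)⌉, for which l + l* = q(p-1). The fixed functional is h =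
-- (-p)^(-q) π^l G₀, in effect u^q π^(-l*) G₀, so π^n h has only n - l* factors π to spend. As π is
-- not invertible, this is read off from (-p)^q π^n h = π^(n+l) G₀ by cancelling powers of -p in ℤ.
--
-- That a ceiling appears and not a floor is due to G₀: π G₀ = -p π δ with δ the indicator of the
-- multiples of p, so the first factor π already yields a whole p, and each further block of p-1
-- factors yields another.

+-interchange : ∀ a b c d → (a ℤ.+ b) ℤ.+ (c ℤ.+ d) ≡ (a ℤ.+ c) ℤ.+ (b ℤ.+ d)
+-interchange = solve-∀

∑ : ℕ → (ℕ → ℤ) → ℤ
∑ zero    f = 0ℤ
∑ (suc n) f = f 0 ℤ.+ ∑ n (f ∘ suc)

∑-cong< : ∀ n {f g} → (∀ {k} → k ℕ.< n → f k ≡ g k) → ∑ n f ≡ ∑ n g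
∑-cong< zero    f≡g = refl
∑-cong< (suc n) f≡g = cong₂ ℤ._+_ (f≡g z<s) (∑-cong< n (f≡g ∘ s<s))

∑-cong : ∀ n {f g} → (∀ k → f k ≡ g k) → ∑ n f ≡ ∑ n g
∑-cong n f≡g = ∑-cong< n (λ {k} _ → f≡g k)

∑-zero : ∀ n → ∑ n (λ _ → 0ℤ) ≡ 0ℤ
∑-zero zero    = refl
∑-zero (suc n) = trans (ℤ.+-identityˡ _) (∑-zero n)

∑-+ : ∀ n f g → ∑ n (λ k → f k ℤ.+ g k) ≡ ∑ n f ℤ.+ ∑ n g
∑-+ zero    f g = refl
∑-+ (suc n) f g =
  trans (cong (ℤ._+_ (f 0 ℤ.+ g 0)) (∑-+ n (f ∘ suc) (g ∘ suc)))
        (+-interchange (f 0) (g 0) (∑ n (f ∘ suc)) (∑ n (g ∘ suc)))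

∑-*ˡ : ∀ n c f → ∑ n (λ k → c ℤ.* f k) ≡ c ℤ.* ∑ n f
∑-*ˡ zero    c f = sym (ℤ.*-zeroʳ c)
∑-*ˡ (suc n) c f =
  trans (cong (ℤ._+_ (c ℤ.* f 0)) (∑-*ˡ n c (f ∘ suc))) (sym (ℤ.*-distribˡ-+ c _ _))

∑-last : ∀ n f → ∑ (suc n) f ≡ ∑ n f ℤ.+ f n
∑-last zero    f = trans (ℤ.+-identityʳ (f 0)) (sym (ℤ.+-identityˡ (f 0)))
∑-last (suc n) f =
  trans (cong (ℤ._+_ (f 0)) (∑-last n (f ∘ suc))) (sym (ℤ.+-assoc (f 0) _ _))

∑-const-1 : ∀ n → ∑ n (λ _ → 1ℤ) ≡ + n
∑-const-1 zero    = refl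
∑-const-1 (suc n) = cong (ℤ._+_ 1ℤ) (∑-const-1 n)

∑-single : ∀ {n j} {f : ℕ → ℤ} → j ℕ.< n → f j ≡ 1ℤ →
           (∀ {k} → k ℕ.< n → k ≢ j → f k ≡ 0ℤ) → ∑ n f ≡ 1ℤ
∑-single {suc n} {zero}  z<s       fj≡1 f≡0 =
  cong₂ ℤ._+_ fj≡1 (trans (∑-cong< n (λ k<n → f≡0 (s<s k<n) λ ())) (∑-zero n))
∑-single {suc n} {suc j} (s<s j<n) fj≡1 f≡0 =
  cong₂ ℤ._+_ (f≡0 z<s λ ()) (∑-single j<n fj≡1 λ k<n k≢j → f≡0 (s<s k<n) (k≢j ∘ ℕ.suc-injective))

infix 10 ±_C_
±_C_ : ℕ → ℕ → ℤ
± n C k = + (n C k) ℤ.* -1ℤ ℤ.^ k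

±-pascal : ∀ n k → ± suc n C suc k ≡ ± n C suc k ℤ.+ -1ℤ ℤ.* ± n C k
±-pascal n k = begin
  + (suc n C suc k) ℤ.* (-1ℤ ℤ.* -1ℤ ℤ.^ k)
    ≡⟨ cong (λ c → + c ℤ.* (-1ℤ ℤ.* -1ℤ ℤ.^ k)) (nCk+nC[k+1]≡[n+1]C[k+1] n k) ⟨
  (+ (n C k) ℤ.+ + (n C suc k)) ℤ.* (-1ℤ ℤ.* -1ℤ ℤ.^ k)
    ≡⟨ rearrange (+ (n C k)) (+ (n C suc k)) (-1ℤ ℤ.^ k) ⟩
  ± n C suc k ℤ.+ -1ℤ ℤ.* ± n C k ∎
  where
  open ≡-Reasoning
  rearrange : ∀ a b s → (a ℤ.+ b) ℤ.* (-1ℤ ℤ.* s) ≡ b ℤ.* (-1ℤ ℤ.* s) ℤ.+ -1ℤ ℤ.* (a ℤ.* s)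
  rearrange = solve-∀

altsum : ℕ → (ℕ → ℤ) → ℤ
altsum n g = ∑ (suc n) (λ k → ± n C k ℤ.* g k)

altsum-suc : ∀ n g → altsum (suc n) g ≡ altsum n g ℤ.+ -1ℤ ℤ.* altsum n (g ∘ suc)
altsum-suc n g = begin
  ± suc n C 0 ℤ.* g 0 ℤ.+ ∑ (suc n) (λ k → ± suc n C suc k ℤ.* g (suc k))
    ≡⟨ cong (ℤ._+_ (± suc n C 0 ℤ.* g 0)) (∑-cong (suc n) λ k →
         trans (cong (ℤ._* g (suc k)) (±-pascal n k)) (expand (± n C suc k) (± n C k) (g (suc k)))) ⟩
  ± n C 0 ℤ.* g 0 ℤ.+ ∑ (suc n) (λ k → ± n C suc k ℤ.* g (suc k) ℤ.+ -1ℤ ℤ.* (± n C k ℤ.* g (suc k)))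
    ≡⟨ cong (ℤ._+_ (± n C 0 ℤ.* g 0))
         (∑-+ (suc n) (λ k → ± n C suc k ℤ.* g (suc k)) (λ k → -1ℤ ℤ.* (± n C k ℤ.* g (suc k)))) ⟩
  ± n C 0 ℤ.* g 0 ℤ.+ (∑ (suc n) (λ k → ± n C suc k ℤ.* g (suc k))
    ℤ.+ ∑ (suc n) (λ k → -1ℤ ℤ.* (± n C k ℤ.* g (suc k))))
    ≡⟨ ℤ.+-assoc (± n C 0 ℤ.* g 0) _ _ ⟨
  ∑ (suc (suc n)) (λ k → ± n C k ℤ.* g k)
    ℤ.+ ∑ (suc n) (λ k → -1ℤ ℤ.* (± n C k ℤ.* g (suc k)))
    -- The first sum runs one index past `n`; the extra term vanishes because C(n, n+1) = 0.
    ≡⟨ cong₂ ℤ._+_ (trans (∑-last (suc n) (λ k → ± n C k ℤ.* g k))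
                     (trans (cong (ℤ._+_ (altsum n g)) last≡0) (ℤ.+-identityʳ (altsum n g))))
                   (∑-*ˡ (suc n) -1ℤ (λ k → ± n C k ℤ.* g (suc k))) ⟩
  altsum n g ℤ.+ -1ℤ ℤ.* altsum n (g ∘ suc) ∎
  where
  open ≡-Reasoning
  expand : ∀ a b x → (a ℤ.+ -1ℤ ℤ.* b) ℤ.* x ≡ a ℤ.* x ℤ.+ -1ℤ ℤ.* (b ℤ.* x)
  expand = solve-∀
  last≡0 : ± n C suc n ℤ.* g (suc n) ≡ 0ℤ
  last≡0 = cong (λ c → + c ℤ.* -1ℤ ℤ.^ suc n ℤ.* g (suc n)) (k>n⇒nCk≡0 (ℕ.n<1+n n))

altsum-cong : ∀ n {f g} → (∀ k → f k ≡ g k) → altsum n f ≡ altsum n g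
altsum-cong n f≡g = ∑-cong (suc n) λ k → cong (± n C k ℤ.*_) (f≡g k)

-- Polynomials acting on functions by shifts

infixl 6 _⊕_
infixl 7 _⊗_

data Poly : Set where
  con     : ℤ → Poly
  X       : Poly
  _⊕_ _⊗_ : Poly → Poly → Poly

⊝_ : Poly → Poly
⊝ P = con -1ℤ ⊗ P

-- X acts on functions ℤ → ℤ as the shift.
act : Poly → (ℤ → ℤ) → ℤ → ℤ
act (con c) f r = c ℤ.* f r
act X       f r = f (r ℤ.- 1ℤ)
act (P ⊕ Q) f r = act P f r ℤ.+ act Q f r
act (P ⊗ Q) f r = act P (act Q f) r

act-cong : ∀ P {f g} → f ≗ g → act P f ≗ act P g
act-cong (con c) f≗g r = cong (c ℤ.*_) (f≗g r)
act-cong X       f≗g r = f≗g _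
act-cong (P ⊕ Q) f≗g r = cong₂ ℤ._+_ (act-cong P f≗g r) (act-cong Q f≗g r)
act-cong (P ⊗ Q) f≗g r = act-cong P (act-cong Q f≗g) r

act-+ : ∀ P f g r → act P (λ s → f s ℤ.+ g s) r ≡ act P f r ℤ.+ act P g r
act-+ (con c) f g r = ℤ.*-distribˡ-+ c _ _
act-+ X       f g r = refl
act-+ (P ⊕ Q) f g r =
  trans (cong₂ ℤ._+_ (act-+ P f g r) (act-+ Q f g r)) (+-interchange (act P f r) _ _ _)
act-+ (P ⊗ Q) f g r = trans (act-cong P (act-+ Q f g) r) (act-+ P (act Q f) (act Q g) r)

act-* : ∀ P c f r → act P (λ s → c ℤ.* f s) r ≡ c ℤ.* act P f r
act-* (con d) c f r = swap d c (f r)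
  where
  swap : ∀ a b x → a ℤ.* (b ℤ.* x) ≡ b ℤ.* (a ℤ.* x)
  swap = solve-∀
act-* X       c f r = refl
act-* (P ⊕ Q) c f r =
  trans (cong₂ ℤ._+_ (act-* P c f r) (act-* Q c f r)) (sym (ℤ.*-distribˡ-+ c _ _))
act-* (P ⊗ Q) c f r = trans (act-cong P (act-* Q c f) r) (act-* P c (act Q f) r)

act-shift : ∀ P f r → act P (λ s → f (s ℤ.- 1ℤ)) r ≡ act P f (r ℤ.- 1ℤ)
act-shift (con c) f r = refl
act-shift X       f r = refl
act-shift (P ⊕ Q) f r = cong₂ ℤ._+_ (act-shift P f r) (act-shift Q f r)
act-shift (P ⊗ Q) f r = trans (act-cong P (act-shift Q f) r) (act-shift P (act Q f) r)

-- Everything is built from constants and one shift, so it suffices that `act P` is additive,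
-- ℤ-linear and commutes with that shift.
act-comm : ∀ P Q f r → act P (act Q f) r ≡ act Q (act P f) r
act-comm P (con c) f r = act-* P c f r
act-comm P X       f r = act-shift P f r
act-comm P (Q ⊕ R) f r =
  trans (act-+ P (act Q f) (act R f) r) (cong₂ ℤ._+_ (act-comm P Q f r) (act-comm P R f r))
act-comm P (Q ⊗ R) f r =
  trans (act-comm P Q (act R f) r) (act-cong Q (act-comm P R f) r)

infixr 8 _^_
_^_ : Poly → ℕ → Poly
P ^ zero  = con 1ℤ
P ^ suc n = P ⊗ P ^ n

1-_ : Poly → Poly
1- P = con 1ℤ ⊕ ⊝ P

psum : ℕ → (ℕ → Poly) → Poly
psum zero    P = con 0ℤ
psum (suc n) P = P 0 ⊕ psum n (P ∘ suc)

act-psum : ∀ n P f r → act (psum n P) f r ≡ ∑ n (λ k → act (P k) f r)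
act-psum zero    P f r = refl
act-psum (suc n) P f r = cong (ℤ._+_ (act (P 0) f r)) (act-psum n (P ∘ suc) f r)

geom : ℕ → Poly → Poly
geom n P = psum n (P ^_)

act-^-suc : ∀ P n f r → act (P ^ suc n) f r ≡ act (P ^ n) (act P f) r
act-^-suc P n f r = act-comm P (P ^ n) f r

act-X^ : ∀ k f r → act (X ^ k) f r ≡ f (r ℤ.- + k)
act-X^ zero    f r = trans (ℤ.*-identityˡ _) (cong f (sym (ℤ.+-identityʳ r)))
act-X^ (suc k) f r = trans (act-X^ k f (r ℤ.- 1ℤ)) (cong f (shift r (+ k)))
  where
  shift : ∀ r k → r ℤ.- 1ℤ ℤ.- k ≡ r ℤ.- (1ℤ ℤ.+ k)
  shift = solve-∀

-- The binomial theorem for operators. The induction moves one `P` onto the function, so `f` has to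
-- vary.
altsum-act : ∀ n P f r → altsum n (λ k → act (P ^ k) f r) ≡ act ((1- P) ^ n) f r
altsum-act zero    P f r = trans (ℤ.+-identityʳ (1ℤ ℤ.* act (P ^ 0) f r)) (ℤ.*-identityˡ (act (P ^ 0) f r))
altsum-act (suc n) P f r = begin
  altsum (suc n) (λ k → act (P ^ k) f r)
    ≡⟨ altsum-suc n (λ k → act (P ^ k) f r) ⟩
  altsum n (λ k → act (P ^ k) f r) ℤ.+ -1ℤ ℤ.* altsum n (λ k → act (P ^ suc k) f r)
    ≡⟨ cong₂ (λ x y → x ℤ.+ -1ℤ ℤ.* y) (altsum-act n P f r)
         (trans (altsum-cong n λ k → act-^-suc P k f r) (altsum-act n P (act P f) r)) ⟩
  act ((1- P) ^ n) f r ℤ.+ -1ℤ ℤ.* act ((1- P) ^ n) (act P f) r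
    ≡⟨ cong₂ (λ x y → x ℤ.+ -1ℤ ℤ.* y) (sym (ℤ.*-identityˡ (act ((1- P) ^ n) f r))) (act-comm ((1- P) ^ n) P f r) ⟩
  act ((1- P) ^ suc n) f r ∎
  where open ≡-Reasoning

∑-telescope : ∀ n (g : ℕ → ℤ) → ∑ n (λ k → 1ℤ ℤ.* g k ℤ.+ -1ℤ ℤ.* g (suc k)) ≡ g 0 ℤ.+ -1ℤ ℤ.* g n
∑-telescope zero    g = cancel (g 0)
  where
  cancel : ∀ x → 0ℤ ≡ x ℤ.+ -1ℤ ℤ.* x
  cancel = solve-∀
∑-telescope (suc n) g =
  trans (cong (ℤ._+_ (1ℤ ℤ.* g 0 ℤ.+ -1ℤ ℤ.* g 1)) (∑-telescope n (g ∘ suc)))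
        (cancel (g 0) (g 1) (g (suc n)))
  where
  cancel : ∀ x y z → (1ℤ ℤ.* x ℤ.+ -1ℤ ℤ.* y) ℤ.+ (y ℤ.+ -1ℤ ℤ.* z) ≡ x ℤ.+ -1ℤ ℤ.* z
  cancel = solve-∀

act-1-P⊗geom : ∀ n P f → act ((1- P) ⊗ geom n P) f ≗ act (1- (P ^ n)) f
act-1-P⊗geom n P f r = begin
  act (1- P) (act (geom n P) f) r
    ≡⟨ act-comm (1- P) (geom n P) f r ⟩
  act (geom n P) (act (1- P) f) r
    ≡⟨ act-psum n (P ^_) (act (1- P) f) r ⟩
  ∑ n (λ k → act (P ^ k) (act (1- P) f) r)
    ≡⟨ ∑-cong n (λ k → act-comm (P ^ k) (1- P) f r) ⟩
  ∑ n (λ k → act (1- P) (act (P ^ k) f) r)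
    ≡⟨ ∑-telescope n (λ k → act (P ^ k) f r) ⟩
  act (1- (P ^ n)) f r ∎
  where open ≡-Reasoning

-- Divisibility of binomial coefficients by a prime

[k+1]*[n+1]C[k+1]≡[n+1]*nCk : ∀ n k → suc k ℕ.* (suc n C suc k) ≡ suc n ℕ.* (n C k)
[k+1]*[n+1]C[k+1]≡[n+1]*nCk zero    zero    = refl
[k+1]*[n+1]C[k+1]≡[n+1]*nCk zero    (suc k) =
  trans (cong (suc (suc k) ℕ.*_) (k>n⇒nCk≡0 {1} {suc (suc k)} (s<s z<s))) (ℕ.*-zeroʳ k)
[k+1]*[n+1]C[k+1]≡[n+1]*nCk (suc n) zero    = begin
  1 ℕ.* (suc (suc n) C 1) ≡⟨ ℕ.*-identityˡ (suc (suc n) C 1) ⟩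
  suc (suc n) C 1         ≡⟨ nC1≡n (suc (suc n)) ⟩
  suc (suc n)             ≡⟨ ℕ.*-identityʳ (suc (suc n)) ⟨
  suc (suc n) ℕ.* 1       ∎
  where open ≡-Reasoning
[k+1]*[n+1]C[k+1]≡[n+1]*nCk (suc n) (suc k) = begin
  suc (suc k) ℕ.* (suc (suc n) C suc (suc k))
    ≡⟨ cong (suc (suc k) ℕ.*_) (nCk+nC[k+1]≡[n+1]C[k+1] (suc n) (suc k)) ⟨
  suc (suc k) ℕ.* ((suc n C suc k) ℕ.+ (suc n C suc (suc k)))
    ≡⟨ split (suc k) (suc n C suc k) (suc n C suc (suc k)) ⟩
  (suc n C suc k) ℕ.+ (suc k ℕ.* (suc n C suc k) ℕ.+ suc (suc k) ℕ.* (suc n C suc (suc k)))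
    ≡⟨ cong ((suc n C suc k) ℕ.+_) (cong₂ ℕ._+_ ([k+1]*[n+1]C[k+1]≡[n+1]*nCk n k)
                                               ([k+1]*[n+1]C[k+1]≡[n+1]*nCk n (suc k))) ⟩
  (suc n C suc k) ℕ.+ (suc n ℕ.* (n C k) ℕ.+ suc n ℕ.* (n C suc k))
    ≡⟨ cong ((suc n C suc k) ℕ.+_) (ℕ.*-distribˡ-+ (suc n) (n C k) (n C suc k)) ⟨
  (suc n C suc k) ℕ.+ suc n ℕ.* ((n C k) ℕ.+ (n C suc k))
    ≡⟨ cong (λ c → (suc n C suc k) ℕ.+ suc n ℕ.* c) (nCk+nC[k+1]≡[n+1]C[k+1] n k) ⟩
  suc (suc n) ℕ.* (suc n C suc k) ∎
  where
  open ≡-Reasoning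
  split : ∀ k a b → suc k ℕ.* (a ℕ.+ b) ≡ a ℕ.+ (k ℕ.* a ℕ.+ suc k ℕ.* b)
  split = ℕSolver.solve-∀

-- By the absorption identity `p` divides (k+1) C(p,k+1), and `k+1` is too small to be a multiple of
-- `p`.
prime∣pC[k+1] : ∀ {p k} → Prime p → suc k ℕ.< p → p ∣ p C suc k
prime∣pC[k+1] {suc M} {k} p-prime k+1<p
  with euclidsLemma (suc k) (suc M C suc k) p-prime
         (divides (M C k) (trans ([k+1]*[n+1]C[k+1]≡[n+1]*nCk M k) (ℕ.*-comm (suc M) (M C k))))
... | inj₁ p∣k+1 = contradiction (ℕ.∣⇒≤ {{ℕ.nonZero}} p∣k+1) (ℕ.<⇒≱ k+1<p)
... | inj₂ p∣C   = p∣C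

-- The quotient ring acting on the kernel of a polynomial

Ker : Poly → (ℤ → ℤ) → Set
Ker Φ f = ∀ r → act Φ f r ≡ 0ℤ

-- Makes `_≈_` below respect products: in `P ⊗ R` the left factor acts on `act R f`, which must
-- again lie in the kernel.
act-Ker : ∀ Φ P f → Ker Φ f → Ker Φ (act P f)
act-Ker Φ P f Φf≡0 r = begin
  act Φ (act P f) r ≡⟨ act-comm Φ P f r ⟩
  act P (act Φ f) r ≡⟨ act-cong P Φf≡0 r ⟩
  act P (λ _ → 0ℤ) r ≡⟨ act-* P 0ℤ (λ _ → 0ℤ) r ⟩
  0ℤ ℤ.* act P (λ _ → 0ℤ) r ≡⟨ ℤ.*-zeroˡ (act P (λ _ → 0ℤ) r) ⟩
  0ℤ ∎
  where open ≡-Reasoning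

-- For Φ = 1 + X + … + X^(p-1) this is the ring ℤ[ζ] of cyclotomic integers.
module Quotient (Φ : Poly) where

  infix 4 _≈_
  -- A record, so that unification recovers `P` and `Q` from the type; the bare function type would
  -- show only their actions.
  record _≈_ (P Q : Poly) : Set where
    constructor mk≈
    field act-≈ : ∀ {f} → Ker Φ f → act P f ≗ act Q f
  open _≈_ public

  ≈-refl : ∀ {P} → P ≈ P
  ≈-refl = mk≈ λ _ _ → refl

  ≈-isEquivalence : IsEquivalence _≈_
  ≈-isEquivalence = record
    { refl  = ≈-refl
    ; sym   = λ P≈Q → mk≈ λ k r → sym (act-≈ P≈Q k r)
    ; trans = λ P≈Q Q≈R → mk≈ λ k r → trans (act-≈ P≈Q k r) (act-≈ Q≈R k r)
    }

  isCommutativeRing : IsCommutativeRing _≈_ _⊕_ _⊗_ ⊝_ (con 0ℤ) (con 1ℤ)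
  isCommutativeRing = record
    { isRing = record
      { +-isAbelianGroup = record
        { isGroup = record
          { isMonoid = record
            { isSemigroup = record
              { isMagma = record
                { isEquivalence = ≈-isEquivalence
                ; ∙-cong = λ P≈Q R≈S → mk≈ λ k r → cong₂ ℤ._+_ (act-≈ P≈Q k r) (act-≈ R≈S k r)
                }
              ; assoc = λ P Q R → mk≈ λ {f} _ r → ℤ.+-assoc (act P f r) (act Q f r) (act R f r)
              }
            ; identity = (λ P → mk≈ λ {f} _ r → zeroˡ (f r) (act P f r))
                       , (λ P → mk≈ λ {f} _ r → zeroʳ (f r) (act P f r))
            }
          ; inverse = (λ P → mk≈ λ {f} _ r → inverseˡ (f r) (act P f r))
                    , (λ P → mk≈ λ {f} _ r → inverseʳ (f r) (act P f r))
          ; ⁻¹-cong = λ P≈Q → mk≈ λ k r → cong (-1ℤ ℤ.*_) (act-≈ P≈Q k r)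
          }
        ; comm = λ P Q → mk≈ λ {f} _ r → ℤ.+-comm (act P f r) (act Q f r)
        }
      ; *-cong = λ {P} {Q} {R} {S} P≈Q R≈S → mk≈ λ k r →
          trans (act-≈ P≈Q (act-Ker Φ R _ k) r) (act-cong Q (act-≈ R≈S k) r)
      ; *-assoc = λ _ _ _ → mk≈ λ _ _ → refl
      ; *-identity = (λ P → mk≈ λ {f} _ r → ℤ.*-identityˡ (act P f r))
                   , (λ P → mk≈ λ {f} _ r → act-cong P (λ s → ℤ.*-identityˡ (f s)) r)
      ; distrib = (λ P Q R → mk≈ λ {f} _ r → act-+ P (act Q f) (act R f) r)
                , (λ P Q R → mk≈ λ _ _ → refl)
      }
    ; *-comm = λ P Q → mk≈ λ {f} _ r → act-comm P Q f r
    }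
    where
    zeroˡ : ∀ x y → 0ℤ ℤ.* x ℤ.+ y ≡ y
    zeroˡ = solve-∀
    zeroʳ : ∀ x y → y ℤ.+ 0ℤ ℤ.* x ≡ y
    zeroʳ = solve-∀
    inverseˡ : ∀ x y → -1ℤ ℤ.* y ℤ.+ y ≡ 0ℤ ℤ.* x
    inverseˡ = solve-∀
    inverseʳ : ∀ x y → y ℤ.+ -1ℤ ℤ.* y ≡ 0ℤ ℤ.* x
    inverseʳ = solve-∀

  commutativeRing : CommutativeRing 0ℓ 0ℓ
  commutativeRing = record { isCommutativeRing = isCommutativeRing }

  module ≈-Reasoning = SetoidReasoning (CommutativeRing.setoid commutativeRing)

  open CommutativeRing commutativeRing public
    using ( commutativeSemiring; *-identityˡ; *-identityʳ; *-assoc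
          ; *-cong; *-congˡ; *-congʳ; +-congˡ; +-congʳ)
    renaming (sym to ≈-sym; trans to ≈-trans)

  open import Algebra.Solver.Ring.NaturalCoefficients.Default commutativeSemiring public
    using (solve; _:=_; _:+_; _:*_)

  ^-congˡ : ∀ n {P Q} → P ≈ Q → P ^ n ≈ Q ^ n
  ^-congˡ zero    P≈Q = ≈-refl
  ^-congˡ (suc n) P≈Q = *-cong P≈Q (^-congˡ n P≈Q)

  ^-homo-⊗ : ∀ P m n → P ^ (m ℕ.+ n) ≈ P ^ m ⊗ P ^ n
  ^-homo-⊗ P zero    n = ≈-sym (*-identityˡ (P ^ n))
  ^-homo-⊗ P (suc m) n = ≈-trans (*-congˡ (^-homo-⊗ P m n)) (≈-sym (*-assoc P (P ^ m) (P ^ n)))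

  ^-assocʳ : ∀ P m n → (P ^ m) ^ n ≈ P ^ (n ℕ.* m)
  ^-assocʳ P m zero    = ≈-refl
  ^-assocʳ P m (suc n) =
    ≈-trans (*-congˡ (^-assocʳ P m n)) (≈-sym (^-homo-⊗ P m (n ℕ.* m)))

  ^-distrib-⊗ : ∀ P Q n → (P ⊗ Q) ^ n ≈ P ^ n ⊗ Q ^ n
  ^-distrib-⊗ P Q zero    = ≈-sym (*-identityˡ (con 1ℤ))
  ^-distrib-⊗ P Q (suc n) =
    ≈-trans (*-congˡ (^-distrib-⊗ P Q n)) (interchange P Q (P ^ n) (Q ^ n))
    where
    interchange : ∀ P Q R S → (P ⊗ Q) ⊗ (R ⊗ S) ≈ (P ⊗ R) ⊗ (Q ⊗ S)
    interchange = solve 4 (λ P Q R S → ((P :* Q) :* (R :* S)) := ((P :* R) :* (Q :* S))) ≈-refl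

  ≈-^-distrib-⊗ : ∀ n {P Q R S} → P ≈ Q ⊗ (R ⊗ S) → P ^ n ≈ Q ^ n ⊗ (R ^ n ⊗ S ^ n)
  ≈-^-distrib-⊗ n {P} {Q} {R} {S} P≈ = begin
    P ^ n                     ≈⟨ ^-congˡ n P≈ ⟩
    (Q ⊗ (R ⊗ S)) ^ n         ≈⟨ ^-distrib-⊗ Q (R ⊗ S) n ⟩
    Q ^ n ⊗ (R ⊗ S) ^ n       ≈⟨ *-congˡ (^-distrib-⊗ R S n) ⟩
    Q ^ n ⊗ (R ^ n ⊗ S ^ n)   ∎
    where open ≈-Reasoning

  con-⊗ : ∀ a b → con a ⊗ con b ≈ con (a ℤ.* b)
  con-⊗ a b = mk≈ λ {f} _ r → sym (ℤ.*-assoc a b (f r))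

  con-^ : ∀ a n → con a ^ n ≈ con (a ℤ.^ n)
  con-^ a zero    = ≈-refl
  con-^ a (suc n) = ≈-trans (*-congˡ (con-^ a n)) (con-⊗ a (a ℤ.^ n))

-- 1 + X + … + X^(p-1) and (1 - X)^(p-1) agree modulo p, because (-1)^k C(p-1,k) ≡ 1.
-- Their difference is p times u X; in ℤ[ζ], where the former vanishes,
-- this reads (1 - ζ)^(p-1) = -p u, and ∑d≡1 gives u ≡ 1 modulo 1 - ζ.
module Cyclotomic (M : ℕ) (p-prime : Prime (suc M)) where

  private
    p = suc M

  -- For `k < p` this is (1 - (-1)^k C(p-1,k)) / p as a telescoping sum: by Pascal's rule, passing
  -- from k to k+1 lowers (-1)^k C(p-1,k) by (-1)^k C(p,k+1), a multiple of `p`.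
  d : ℕ → ℤ
  d zero    = 0ℤ
  d (suc k) = d k ℤ.+ -1ℤ ℤ.^ k ℤ.* + (ℕ._/_ (p C suc k) p {{ℕ.nonZero}})

  ±pC+p*d≡1 : ∀ {k} → k ℕ.< p → ± M C k ℤ.+ + p ℤ.* d k ≡ 1ℤ
  ±pC+p*d≡1 {zero}  _     = cong (ℤ._+_ 1ℤ) (ℤ.*-zeroʳ (+ p))
  ±pC+p*d≡1 {suc k} k+1<p = begin
    ± M C suc k ℤ.+ + p ℤ.* (d k ℤ.+ s ℤ.* + c)
      ≡⟨ regroup (± M C suc k) (± M C k) (+ p) (d k) s (+ c) ⟩
    (± M C suc k ℤ.+ -1ℤ ℤ.* ± M C k) ℤ.+ (± M C k ℤ.+ + p ℤ.* d k) ℤ.+ + c ℤ.* + p ℤ.* s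
      ≡⟨ cong₂ (λ x y → x ℤ.+ y ℤ.+ + c ℤ.* + p ℤ.* s)
               (sym (±-pascal M k)) (±pC+p*d≡1 (ℕ.<⇒≤ k+1<p)) ⟩
    + (p C suc k) ℤ.* (-1ℤ ℤ.* s) ℤ.+ 1ℤ ℤ.+ + c ℤ.* + p ℤ.* s
      ≡⟨ cong (λ x → x ℤ.* (-1ℤ ℤ.* s) ℤ.+ 1ℤ ℤ.+ + c ℤ.* + p ℤ.* s)
              (trans (cong +_ (sym (ℕ.m/n*n≡m {{ℕ.nonZero}} (prime∣pC[k+1] p-prime k+1<p)))) (ℤ.pos-* c p)) ⟩
    + c ℤ.* + p ℤ.* (-1ℤ ℤ.* s) ℤ.+ 1ℤ ℤ.+ + c ℤ.* + p ℤ.* s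
      ≡⟨ cancel (+ c ℤ.* + p) s ⟩
    1ℤ ∎
    where
    open ≡-Reasoning
    s = -1ℤ ℤ.^ k
    c = ℕ._/_ (p C suc k) p {{ℕ.nonZero}}
    regroup : ∀ a b p d s c → a ℤ.+ p ℤ.* (d ℤ.+ s ℤ.* c) ≡
              (a ℤ.+ -1ℤ ℤ.* b) ℤ.+ (b ℤ.+ p ℤ.* d) ℤ.+ c ℤ.* p ℤ.* s
    regroup = solve-∀
    cancel : ∀ y s → y ℤ.* (-1ℤ ℤ.* s) ℤ.+ 1ℤ ℤ.+ y ℤ.* s ≡ 1ℤ
    cancel = solve-∀

  -- Stated for any sequence `g`, since it is used both for the powers of an element and for the
  -- constant 1.
  ∑≡altsum+p*∑d : ∀ g → ∑ p g ≡ altsum M g ℤ.+ + p ℤ.* ∑ p (λ k → d k ℤ.* g k)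
  ∑≡altsum+p*∑d g = begin
    ∑ p g
      ≡⟨ ∑-cong< p (λ {k} k<p → trans (sym (ℤ.*-identityˡ (g k)))
           (trans (cong (ℤ._* g k) (sym (±pC+p*d≡1 k<p))) (expand (± M C k) (+ p) (d k) (g k)))) ⟩
    ∑ p (λ k → ± M C k ℤ.* g k ℤ.+ + p ℤ.* (d k ℤ.* g k))
      ≡⟨ ∑-+ p (λ k → ± M C k ℤ.* g k) (λ k → + p ℤ.* (d k ℤ.* g k)) ⟩
    altsum M g ℤ.+ ∑ p (λ k → + p ℤ.* (d k ℤ.* g k))
      ≡⟨ cong (ℤ._+_ (altsum M g)) (∑-*ˡ p (+ p) (λ k → d k ℤ.* g k)) ⟩
    altsum M g ℤ.+ + p ℤ.* ∑ p (λ k → d k ℤ.* g k) ∎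
    where
    open ≡-Reasoning
    expand : ∀ e p d x → (e ℤ.+ p ℤ.* d) ℤ.* x ≡ e ℤ.* x ℤ.+ p ℤ.* (d ℤ.* x)
    expand = solve-∀

  -- At the constant 1 the alternating sum is (1-1)^(p-1) = 0, as p > 1, which leaves p = p ∑ d.
  ∑d≡1 : ∑ p d ≡ 1ℤ
  ∑d≡1 = ℤ.*-cancelˡ-≡ (+ p) (∑ p d) 1ℤ {{ℕ.nonZero}} (begin
    + p ℤ.* ∑ p d
      ≡⟨ cong (+ p ℤ.*_) (∑-cong p λ k → ℤ.*-identityʳ (d k)) ⟨
    + p ℤ.* ∑ p (λ k → d k ℤ.* 1ℤ)
      ≡⟨ ℤ.+-identityˡ (+ p ℤ.* ∑ p (λ k → d k ℤ.* 1ℤ)) ⟨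
    0ℤ ℤ.+ + p ℤ.* ∑ p (λ k → d k ℤ.* 1ℤ)
      ≡⟨ cong (ℤ._+ (+ p ℤ.* ∑ p (λ k → d k ℤ.* 1ℤ))) (altsum-1 (prime⇒nonTrivial p-prime)) ⟨
    altsum M (λ _ → 1ℤ) ℤ.+ + p ℤ.* ∑ p (λ k → d k ℤ.* 1ℤ)
      ≡⟨ ∑≡altsum+p*∑d (λ _ → 1ℤ) ⟨
    ∑ p (λ _ → 1ℤ)
      ≡⟨ ∑-const-1 p ⟩
    + p
      ≡⟨ ℤ.*-identityʳ (+ p) ⟨
    + p ℤ.* 1ℤ ∎)
    where
    open ≡-Reasoning
    cancel : ∀ x → x ℤ.+ -1ℤ ℤ.* x ≡ 0ℤ
    cancel = solve-∀
    altsum-1 : ∀ {m} → ℕ.NonTrivial (suc m) → altsum m (λ _ → 1ℤ) ≡ 0ℤ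
    altsum-1 {suc m} _ =
      trans (altsum-suc m (λ _ → 1ℤ)) (cancel (altsum m (λ _ → 1ℤ)))

  -- A function of `P`, because the induction on `a` evaluates it at `u X ^ (p ℕ.^ a)` as well as at
  -- `X`.
  u : Poly → Poly
  u P = psum p (λ k → con (d k) ⊗ P ^ k)

  w : Poly → Poly
  w P = psum p (λ k → con (d k) ⊗ geom k P)

  act-geom-p : ∀ P f → act (geom p P) f ≗ act ((1- P) ^ M ⊕ con (+ p) ⊗ u P) f
  act-geom-p P f r = begin
    act (geom p P) f r
      ≡⟨ act-psum p (P ^_) f r ⟩
    ∑ p (λ k → act (P ^ k) f r)
      ≡⟨ ∑≡altsum+p*∑d (λ k → act (P ^ k) f r) ⟩
    altsum M (λ k → act (P ^ k) f r) ℤ.+ + p ℤ.* ∑ p (λ k → d k ℤ.* act (P ^ k) f r)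
      ≡⟨ cong₂ (λ x y → x ℤ.+ + p ℤ.* y) (altsum-act M P f r)
               (sym (act-psum p (λ k → con (d k) ⊗ P ^ k) f r)) ⟩
    act ((1- P) ^ M ⊕ con (+ p) ⊗ u P) f r ∎
    where open ≡-Reasoning

  -- As the coefficients sum to 1, 1 - u(P) = ∑ d_k (1 - P^k); `w P` collects the cofactors of 1 -
  -- P.
  act-1-u : ∀ P f → act (1- (u P)) f ≗ act ((1- P) ⊗ w P) f
  act-1-u P f r = sym (begin
    act (1- P) (act (w P) f) r
      ≡⟨ act-comm (1- P) (w P) f r ⟩
    act (w P) (act (1- P) f) r
      ≡⟨ act-psum p (λ k → con (d k) ⊗ geom k P) (act (1- P) f) r ⟩
    ∑ p (λ k → d k ℤ.* act (geom k P) (act (1- P) f) r)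
      ≡⟨ ∑-cong p (λ k → trans
           (cong (d k ℤ.*_) (trans (act-comm (geom k P) (1- P) f r) (act-1-P⊗geom k P f r)))
           (expand (d k) (f r) (act (P ^ k) f r))) ⟩
    ∑ p (λ k → f r ℤ.* d k ℤ.+ -1ℤ ℤ.* (d k ℤ.* act (P ^ k) f r))
      ≡⟨ ∑-+ p (λ k → f r ℤ.* d k) (λ k → -1ℤ ℤ.* (d k ℤ.* act (P ^ k) f r)) ⟩
    ∑ p (λ k → f r ℤ.* d k) ℤ.+ ∑ p (λ k → -1ℤ ℤ.* (d k ℤ.* act (P ^ k) f r))
      ≡⟨ cong₂ ℤ._+_ (∑-*ˡ p (f r) d) (∑-*ˡ p -1ℤ (λ k → d k ℤ.* act (P ^ k) f r)) ⟩
    f r ℤ.* ∑ p d ℤ.+ -1ℤ ℤ.* ∑ p (λ k → d k ℤ.* act (P ^ k) f r)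
      ≡⟨ cong₂ (λ x y → x ℤ.+ -1ℤ ℤ.* y)
               (trans (cong (f r ℤ.*_) ∑d≡1) (ℤ.*-comm (f r) 1ℤ))
               (sym (act-psum p (λ k → con (d k) ⊗ P ^ k) f r)) ⟩
    act (1- (u P)) f r ∎)
    where
    open ≡-Reasoning
    expand : ∀ d x y → d ℤ.* (1ℤ ℤ.* x ℤ.+ -1ℤ ℤ.* y) ≡ x ℤ.* d ℤ.+ -1ℤ ℤ.* (d ℤ.* y)
    expand = solve-∀

  -- The element π and the powers of u

  open Quotient (geom p X)

  π : Poly
  π = 1- X

  π^M≈-pu : π ^ M ≈ con (ℤ.- + p) ⊗ u X
  π^M≈-pu = mk≈ λ {f} k r →
    isolate (act (π ^ M) f r) (+ p) (act (u X) f r) (trans (sym (act-geom-p X f r)) (k r))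
    where
    regroup : ∀ x p y → x ≡ (x ℤ.+ p ℤ.* y) ℤ.+ ℤ.- p ℤ.* y
    regroup = solve-∀
    isolate : ∀ x p y → x ℤ.+ p ℤ.* y ≡ 0ℤ → x ≡ ℤ.- p ℤ.* y
    isolate x p y x+py≡0 =
      trans (regroup x p y) (trans (cong (ℤ._+ (ℤ.- p ℤ.* y)) x+py≡0) (ℤ.+-identityˡ (ℤ.- p ℤ.* y)))

  -- The solver works over a commutative semiring, so the sign is split off as an element that it
  -- can treat as a variable.
  con-neg : ∀ a → con (ℤ.- a) ≈ con a ⊗ con -1ℤ
  con-neg a = mk≈ λ {f} _ r → commute a (f r)
    where
    commute : ∀ a x → ℤ.- a ℤ.* x ≡ a ℤ.* (-1ℤ ℤ.* x)
    commute = solve-∀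

  1--cong : ∀ {P Q} → P ≈ Q → 1- P ≈ 1- Q
  1--cong P≈Q = +-congˡ (*-congˡ P≈Q)

  1-u^[p^a] : ∀ a → ∃ λ W → 1- (u X ^ (p ℕ.^ a)) ≈ con ((+ p) ℤ.^ a) ⊗ (π ⊗ W)
  1-u^[p^a] zero = w X , (begin
    1- (u X ⊗ con 1ℤ)         ≈⟨ 1--cong (*-identityʳ (u X)) ⟩
    1- (u X)                  ≈⟨ mk≈ (λ {f} _ → act-1-u X f) ⟩
    π ⊗ w X                   ≈⟨ *-identityˡ (π ⊗ w X) ⟨
    con 1ℤ ⊗ (π ⊗ w X)        ∎)
    where open ≈-Reasoning
  1-u^[p^a] (suc a) with 1-u^[p^a] a
  ... | W , 1-V≈ = W ⊗ (con -1ℤ ⊗ (y ^ M ⊗ (u X ⊗ W ^ M)) ⊕ u V) , (begin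
    1- (u X ^ (p ℕ.^ suc a))
      ≈⟨ 1--cong (^-assocʳ (u X) (p ℕ.^ a) p) ⟨
    1- (V ^ p)
      ≈⟨ mk≈ (λ {f} _ r → act-1-P⊗geom p V f r) ⟨
    (1- V) ⊗ geom p V
      ≈⟨ *-cong 1-V≈ (mk≈ (λ {f} _ → act-geom-p V f)) ⟩
    (y ⊗ (π ⊗ W)) ⊗ ((1- V) ^ M ⊕ con (+ p) ⊗ u V)
      ≈⟨ *-congˡ (+-congʳ (≈-^-distrib-⊗ M 1-V≈)) ⟩
    (y ⊗ (π ⊗ W)) ⊗ (y ^ M ⊗ (π ^ M ⊗ W ^ M) ⊕ con (+ p) ⊗ u V)
      -- The first summand gets its factor `p` from `π ^ M`. For `a = 0` the power `y ^ M` is 1, so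
      -- only `π` can supply it; hence `π` is part of the statement.
      ≈⟨ *-congˡ (+-congʳ (*-congˡ (*-congʳ (≈-trans π^M≈-pu (*-congʳ (con-neg (+ p))))))) ⟩
    (y ⊗ (π ⊗ W)) ⊗ (y ^ M ⊗ (((con (+ p) ⊗ con -1ℤ) ⊗ u X) ⊗ W ^ M) ⊕ con (+ p) ⊗ u V)
      ≈⟨ solve 9 (λ y π W yᴹ c n u Wᴹ v →
           ((y :* (π :* W)) :* (yᴹ :* (((c :* n) :* u) :* Wᴹ) :+ c :* v))
             := ((c :* y) :* (π :* (W :* (n :* (yᴹ :* (u :* Wᴹ)) :+ v)))))
           ≈-refl y π W (y ^ M) (con (+ p)) (con -1ℤ) (u X) (W ^ M) (u V) ⟩
    (con (+ p) ⊗ y) ⊗ (π ⊗ (W ⊗ (con -1ℤ ⊗ (y ^ M ⊗ (u X ⊗ W ^ M)) ⊕ u V)))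
      ≈⟨ *-congʳ (con-⊗ (+ p) ((+ p) ℤ.^ a)) ⟩
    con ((+ p) ℤ.^ suc a) ⊗ (π ⊗ (W ⊗ (con -1ℤ ⊗ (y ^ M ⊗ (u X ⊗ W ^ M)) ⊕ u V))) ∎)
    where
    open ≈-Reasoning
    V = u X ^ (p ℕ.^ a)
    y = con ((+ p) ℤ.^ a)

  -- The indicator of the multiples of p and its images under π

  -- The sign makes `δ (r - k)` test `k - r`, the condition by which `C[ p ]` filters.
  δ : ℤ → ℤ
  δ z = if does (+ p ∣? ℤ.- z) then 1ℤ else 0ℤ

  δ-∣ : ∀ {z} → + p ℤ.∣ ℤ.- z → δ z ≡ 1ℤ
  δ-∣ {z} p∣-z = cong (λ b → if b then 1ℤ else 0ℤ) (dec-true (+ p ∣? ℤ.- z) p∣-z)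

  δ-∤ : ∀ {z} → ¬ + p ℤ.∣ ℤ.- z → δ z ≡ 0ℤ
  δ-∤ {z} p∤-z = cong (λ b → if b then 1ℤ else 0ℤ) (dec-false (+ p ∣? ℤ.- z) p∤-z)

  ∑δ≡1 : ∀ r → ∑ p (λ k → δ (r ℤ.- + k)) ≡ 1ℤ
  ∑δ≡1 r = ∑-single (n%ℕd<d r p {{ℕ.nonZero}}) (δ-∣ (ℤ.divides (ℤ.- q) residue)) λ {k} k<p k≢j →
    δ-∤ {r ℤ.- + k} λ p∣k-r → contradiction
      (ℤ.∣⇒∣ᵤ (subst (+ p ℤ.∣_) (shift k) (ℤ.∣m∣n⇒∣m+n p∣k-r (ℤ.divides q refl))))
      (k≢j→p∤k⊖j k<p k≢j)
    where
    j = _%ℕ_ r p {{ℕ.nonZero}}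
    q = _/ℕ_ r p {{ℕ.nonZero}}
    r≡ = a≡a%ℕn+[a/ℕn]*n r p {{ℕ.nonZero}}
    simplify : ∀ j q → ℤ.- ((j ℤ.+ q) ℤ.- j) ≡ ℤ.- q
    simplify = solve-∀
    residue : ℤ.- (r ℤ.- + j) ≡ ℤ.- q ℤ.* + p
    residue = trans (cong (λ r → ℤ.- (r ℤ.- + j)) r≡)
                    (trans (simplify (+ j) (q ℤ.* + p)) (ℤ.neg-distribˡ-* q (+ p)))
    simplify′ : ∀ k j q → ℤ.- (j ℤ.+ q ℤ.- k) ℤ.+ q ≡ k ℤ.- j
    simplify′ = solve-∀
    shift : ∀ k → ℤ.- (r ℤ.- + k) ℤ.+ q ℤ.* + p ≡ k ℤ.⊖ j
    shift k = trans (cong (λ r → ℤ.- (r ℤ.- + k) ℤ.+ q ℤ.* + p) r≡)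
                    (trans (simplify′ (+ k) (+ j) (q ℤ.* + p)) (ℤ.m-n≡m⊖n k j))
    k≢j→p∤k⊖j : ∀ {k} → k ℕ.< p → k ≢ j → ¬ p ∣ ℤ.∣ k ℤ.⊖ j ∣
    k≢j→p∤k⊖j {k} k<p k≢j p∣ = contradiction
      (ℕ.∣⇒≤ {{ℕ.≢-nonZero ∣k-j∣≢0}} p∣)
      (ℕ.<⇒≱ (ℕ.≤-<-trans (ℤ.∣m⊝n∣≤m⊔n k j) (ℕ.⊔-lub k<p (n%ℕd<d r p {{ℕ.nonZero}}))))
      where
      ∣k-j∣≢0 : ℤ.∣ k ℤ.⊖ j ∣ ≢ 0
      ∣k-j∣≢0 eq = k≢j (ℤ.+-injective (ℤ.i-j≡0⇒i≡j (+ k) (+ j) (trans (ℤ.m-n≡m⊖n k j) (ℤ.∣i∣≡0⇒i≡0 eq))))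

  -- G₀ is F_p(0, ·), minus the trace of ζ^(-r); in terms of it the exceptional case
  -- n = 0 of the Fleck quotient disappears: (-p)^⌈n/(p-1)⌉ F_p(n, ·) = π^n G₀ for every n.
  G₀ : ℤ → ℤ
  G₀ r = 1ℤ ℤ.+ ℤ.- + p ℤ.* δ r

  -- `π` kills the constant summand 1, so a single `π` brings out a factor -p.
  act-π-G₀ : ∀ r → act π G₀ r ≡ ℤ.- + p ℤ.* act π δ r
  act-π-G₀ r = factor (ℤ.- + p) (δ r) (δ (r ℤ.- 1ℤ))
    where
    factor : ∀ p x y → 1ℤ ℤ.* (1ℤ ℤ.+ p ℤ.* x) ℤ.+ -1ℤ ℤ.* (1ℤ ℤ.+ p ℤ.* y)
             ≡ p ℤ.* (1ℤ ℤ.* x ℤ.+ -1ℤ ℤ.* y)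
    factor = solve-∀

  G₀∈Ker : Ker (geom p X) G₀
  G₀∈Ker r = begin
    act (geom p X) G₀ r
      ≡⟨ act-psum p (X ^_) G₀ r ⟩
    ∑ p (λ k → act (X ^ k) G₀ r)
      ≡⟨ ∑-cong p (λ k → act-X^ k G₀ r) ⟩
    ∑ p (λ k → 1ℤ ℤ.+ ℤ.- + p ℤ.* δ (r ℤ.- + k))
      ≡⟨ ∑-+ p (λ _ → 1ℤ) (λ k → ℤ.- + p ℤ.* δ (r ℤ.- + k)) ⟩
    ∑ p (λ _ → 1ℤ) ℤ.+ ∑ p (λ k → ℤ.- + p ℤ.* δ (r ℤ.- + k))
      ≡⟨ cong₂ ℤ._+_ (∑-const-1 p)
           (trans (∑-*ˡ p (ℤ.- + p) (λ k → δ (r ℤ.- + k))) (cong (ℤ.- + p ℤ.*_) (∑δ≡1 r))) ⟩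
    + p ℤ.+ ℤ.- + p ℤ.* 1ℤ
      ≡⟨ cancel (+ p) ⟩
    0ℤ ∎
    where
    open ≡-Reasoning
    cancel : ∀ x → x ℤ.+ ℤ.- x ℤ.* 1ℤ ≡ 0ℤ
    cancel = solve-∀

  -- `δ` itself is outside the kernel, its sum over a period being 1. But -p times `act π δ` is
  -- `act π G₀`, and ℤ has no torsion.
  πδ∈Ker : Ker (geom p X) (act π δ)
  πδ∈Ker r = ℤ.*-cancelˡ-≡ (ℤ.- + p) (act (geom p X) (act π δ) r) 0ℤ {{ℕ.nonZero}} (begin
    ℤ.- + p ℤ.* act (geom p X) (act π δ) r
      ≡⟨ act-* (geom p X) (ℤ.- + p) (act π δ) r ⟨
    act (geom p X) (λ s → ℤ.- + p ℤ.* act π δ s) r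
      ≡⟨ act-cong (geom p X) act-π-G₀ r ⟨
    act (geom p X) (act π G₀) r
      ≡⟨ act-Ker (geom p X) π G₀ G₀∈Ker r ⟩
    0ℤ
      ≡⟨ ℤ.*-zeroʳ (ℤ.- + p) ⟨
    ℤ.- + p ℤ.* 0ℤ ∎)
    where open ≡-Reasoning

  π^[M*q+t] : ∀ q t → π ^ (q ℕ.* M ℕ.+ t) ≈ con ((ℤ.- + p) ℤ.^ q) ⊗ (u X ^ q ⊗ π ^ t)
  π^[M*q+t] q t = begin
    π ^ (q ℕ.* M ℕ.+ t)
      ≈⟨ ^-homo-⊗ π (q ℕ.* M) t ⟩
    π ^ (q ℕ.* M) ⊗ π ^ t
      ≈⟨ *-congʳ (^-assocʳ π M q) ⟨
    (π ^ M) ^ q ⊗ π ^ t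
      ≈⟨ *-congʳ (^-congˡ q π^M≈-pu) ⟩
    (con (ℤ.- + p) ⊗ u X) ^ q ⊗ π ^ t
      ≈⟨ *-congʳ (≈-trans (^-distrib-⊗ (con (ℤ.- + p)) (u X) q) (*-congʳ (con-^ (ℤ.- + p) q))) ⟩
    (con ((ℤ.- + p) ℤ.^ q) ⊗ u X ^ q) ⊗ π ^ t
      ≈⟨ *-assoc (con ((ℤ.- + p) ℤ.^ q)) (u X ^ q) (π ^ t) ⟩
    con ((ℤ.- + p) ℤ.^ q) ⊗ (u X ^ q ⊗ π ^ t) ∎
    where open ≈-Reasoning

  act-π^suc-G₀ : ∀ n r → act (π ^ suc n) G₀ r ≡ ℤ.- + p ℤ.* act (π ^ n) (act π δ) r
  act-π^suc-G₀ n r =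
    trans (act-comm π (π ^ n) G₀ r)
          (trans (act-cong (π ^ n) act-π-G₀ r) (act-* (π ^ n) (ℤ.- + p) (act π δ) r))

  -- The bound says q ≤ ⌈m/M⌉. The first factor -p costs one `π`, by `act-π^suc-G₀`; each of the
  -- others costs `M` of them.
  act-π^-G₀ : ∀ q m → q ℕ.* M ℕ.< m ℕ.+ M →
              ∃ λ h → Ker (geom p X) h × (∀ r → act (π ^ m) G₀ r ≡ (ℤ.- + p) ℤ.^ q ℤ.* h r)
  act-π^-G₀ zero    m _ =
    act (π ^ m) G₀ , act-Ker (geom p X) (π ^ m) G₀ G₀∈Ker , λ r → sym (ℤ.*-identityˡ (act (π ^ m) G₀ r))
  act-π^-G₀ (suc q) m M+qM<m+M = h , act-Ker (geom p X) (u X ^ q ⊗ π ^ t) (act π δ) πδ∈Ker , λ r → begin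
    act (π ^ m) G₀ r
      ≡⟨ cong (λ n → act (π ^ n) G₀ r) m≡ ⟩
    act (π ^ suc (q ℕ.* M ℕ.+ t)) G₀ r
      ≡⟨ act-π^suc-G₀ (q ℕ.* M ℕ.+ t) r ⟩
    ℤ.- + p ℤ.* act (π ^ (q ℕ.* M ℕ.+ t)) (act π δ) r
      ≡⟨ cong (ℤ.- + p ℤ.*_) (act-≈ (π^[M*q+t] q t) πδ∈Ker r) ⟩
    ℤ.- + p ℤ.* ((ℤ.- + p) ℤ.^ q ℤ.* h r)
      ≡⟨ ℤ.*-assoc (ℤ.- + p) ((ℤ.- + p) ℤ.^ q) (h r) ⟨
    (ℤ.- + p) ℤ.^ suc q ℤ.* h r ∎
    where
    open ≡-Reasoning
    qM<m : q ℕ.* M ℕ.< m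
    qM<m = ℕ.+-cancelˡ-< M (q ℕ.* M) m (subst (M ℕ.+ q ℕ.* M ℕ.<_) (ℕ.+-comm m M) M+qM<m+M)
    t = m ∸ suc (q ℕ.* M)
    m≡ : m ≡ suc (q ℕ.* M ℕ.+ t)
    m≡ = sym (ℕ.m+[n∸m]≡n qM<m)
    h = act (u X ^ q ⊗ π ^ t) (act π δ)

  altsum-act-u : ∀ a n → ∃ λ W → ∀ {h} → Ker (geom p X) h → ∀ r →
    altsum n (λ k → act (u X ^ (k ℕ.* p ℕ.^ a)) h r) ≡ (+ p) ℤ.^ (a ℕ.* n) ℤ.* act W (act (π ^ n) h) r
  altsum-act-u a n with 1-u^[p^a] a
  ... | W , 1-V≈ = W ^ n , λ {h} h∈Ker r → begin
    altsum n (λ k → act (u X ^ (k ℕ.* p ℕ.^ a)) h r)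
      ≡⟨ altsum-cong n (λ k → act-≈ (^-assocʳ (u X) (p ℕ.^ a) k) {h} h∈Ker r) ⟨
    altsum n (λ k → act (V ^ k) h r)
      ≡⟨ altsum-act n V h r ⟩
    act ((1- V) ^ n) h r
      ≡⟨ act-≈ (≈-^-distrib-⊗ n 1-V≈) h∈Ker r ⟩
    act (con ((+ p) ℤ.^ a) ^ n) (act (π ^ n) (act (W ^ n) h)) r
      ≡⟨ act-≈ (con-^ ((+ p) ℤ.^ a) n) (act-Ker (geom p X) (π ^ n ⊗ W ^ n) h h∈Ker) r ⟩
    ((+ p) ℤ.^ a) ℤ.^ n ℤ.* act (π ^ n) (act (W ^ n) h) r
      ≡⟨ cong₂ ℤ._*_ (ℤ.^-*-assoc (+ p) a n) (act-comm (π ^ n) (W ^ n) h r) ⟩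
    (+ p) ℤ.^ (a ℕ.* n) ℤ.* act (W ^ n) (act (π ^ n) h) r ∎
    where
    open ≡-Reasoning
    V = u X ^ (p ℕ.^ a)

-- Rational arithmetic

-- One half of the uniqueness of the quotient in division with remainder; `floor-/` uses it in both
-- directions.
quotient-≤ : ∀ {n ρ ρ′ z z′} → ρ′ ℕ.< n →
             + ρ ℤ.+ z ℤ.* + n ≡ + ρ′ ℤ.+ z′ ℤ.* + n → z ℤ.≤ z′
quotient-≤ {n} {ρ} {ρ′} {z} {z′} ρ′<n eq =
  subst (z ℤ.≤_) (ℤ.pred-suc z′) (ℤ.i<j⇒i≤pred[j] (ℤ.*-cancelʳ-<-nonNeg {z} {ℤ.suc z′} (+ n) (begin-strict
  z ℤ.* + n              ≤⟨ ℤ.i≤j+i (z ℤ.* + n) (+ ρ) ⟩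
  + ρ ℤ.+ z ℤ.* + n      ≡⟨ eq ⟩
  + ρ′ ℤ.+ z′ ℤ.* + n    <⟨ ℤ.+-monoˡ-< (z′ ℤ.* + n) (ℤ.+<+ ρ′<n) ⟩
  + n ℤ.+ z′ ℤ.* + n     ≡⟨ distrib z′ (+ n) ⟩
  ℤ.suc z′ ℤ.* + n       ∎)))
  where
  open ℤ.≤-Reasoning
  distrib : ∀ z n → n ℤ.+ z ℤ.* n ≡ (1ℤ ℤ.+ z) ℤ.* n
  distrib = solve-∀

↥≡%+floor*↧ : ∀ q → ∃ λ ρ → ρ ℕ.< ↧ₙ q × ↥ q ≡ + ρ ℤ.+ floor q ℤ.* ↧ q
↥≡%+floor*↧ q@record{} =
  _ , n%d<d (↥ q) (↧ q) {{ℕ.nonZero}} , a≡a%n+[a/n]*n (↥ q) (↧ q) {{ℕ.nonZero}}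

floor-/ : ∀ {i n z ρ} .{{_ : ℕ.NonZero n}} → ρ ℕ.< n → i ≡ + ρ ℤ.+ z ℤ.* + n → floor (i / n) ≡ z
floor-/ {i} {n} {z} {ρ} ρ<n i≡ with ↥≡%+floor*↧ (i / n)
... | σ , σ<d , ↥≡ = ℤ.≤-antisym (quotient-≤ ρ<n (trans (sym i≡σg) i≡)) (quotient-≤ σg<n (trans (sym i≡) i≡σg))
  where
  open ≡-Reasoning
  g = ℤ.gcd i (+ n)
  gₙ = ℤ.∣ g ∣
  n≡ : ↧ₙ (i / n) ℕ.* gₙ ≡ n
  n≡ = ℤ.+-injective (trans (ℤ.pos-* (↧ₙ (i / n)) gₙ) (ℚ.↧-/ i n))
  expand : ∀ s f d g → (s ℤ.+ f ℤ.* d) ℤ.* g ≡ s ℤ.* g ℤ.+ f ℤ.* (d ℤ.* g)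
  expand = solve-∀
  -- `i / n` is stored in lowest terms. Multiplying its division by the gcd restores `i` and `n` and
  -- scales the remainder.
  i≡σg : i ≡ + (σ ℕ.* gₙ) ℤ.+ floor (i / n) ℤ.* + n
  i≡σg = begin
    i                                                    ≡⟨ ℚ.↥-/ i n ⟨
    ↥ (i / n) ℤ.* g                                      ≡⟨ cong (ℤ._* g) ↥≡ ⟩
    (+ σ ℤ.+ floor (i / n) ℤ.* ↧ (i / n)) ℤ.* g          ≡⟨ expand (+ σ) (floor (i / n)) (↧ (i / n)) g ⟩
    + σ ℤ.* g ℤ.+ floor (i / n) ℤ.* (↧ (i / n) ℤ.* g)    ≡⟨ cong₂ (λ x y → x ℤ.+ floor (i / n) ℤ.* y)
                                                              (sym (ℤ.pos-* σ gₙ)) (ℚ.↧-/ i n) ⟩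
    + (σ ℕ.* gₙ) ℤ.+ floor (i / n) ℤ.* + n               ∎
  gₙ≢0 : ℕ.NonZero gₙ
  gₙ≢0 = ℕ.m*n≢0⇒n≢0 (↧ₙ (i / n)) {{subst ℕ.NonZero (sym n≡) it}}
  σg<n : σ ℕ.* gₙ ℕ.< n
  σg<n = subst (σ ℕ.* gₙ ℕ.<_) n≡ (ℕ.*-monoˡ-< gₙ {{gₙ≢0}} σ<d)

neg-/ : ∀ i n .{{_ : ℕ.NonZero n}} → ℚ.- (i / n) ≡ (ℤ.- i) / n
neg-/ (+ zero)  n = trans (cong ℚ.-_ (ℚ.0/n≡0 n)) (sym (ℚ.0/n≡0 n))
neg-/ ℤ.+[1+ i ] n = refl
neg-/ -[1+ i ]  n = GroupProperties.⁻¹-involutive ℚ.+-0-group (ℚ.normalize (suc i) n)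

ceiling≡-floor- : ∀ q → ceiling q ≡ ℤ.- floor (ℚ.- q)
ceiling≡-floor- record{} = refl

ceiling-/ : ∀ {i n z ρ} .{{_ : ℕ.NonZero n}} → ρ ℕ.< n → i ℤ.+ + ρ ≡ z ℤ.* + n → ceiling (i / n) ≡ z
ceiling-/ {i} {n} {z} {ρ} ρ<n i+ρ≡ = begin
  ceiling (i / n)             ≡⟨ ceiling≡-floor- (i / n) ⟩
  ℤ.- floor (ℚ.- (i / n))     ≡⟨ cong (ℤ.-_ ∘ floor) (neg-/ i n) ⟩
  ℤ.- floor ((ℤ.- i) / n)     ≡⟨ cong ℤ.-_ (floor-/ {ℤ.- i} {n} {ℤ.- z} ρ<n
                                   (trans (move i (+ ρ)) (cong (ℤ._+_ (+ ρ))
                                     (trans (cong ℤ.-_ i+ρ≡) (ℤ.neg-distribˡ-* z (+ n)))))) ⟩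
  ℤ.- (ℤ.- z)                 ≡⟨ ℤ.neg-involutive z ⟩
  z                           ∎
  where
  open ≡-Reasoning
  move : ∀ i r → ℤ.- i ≡ r ℤ.+ ℤ.- (i ℤ.+ r)
  move = solve-∀

toℚᵘ-ι : ∀ i → ℚ.toℚᵘ (ι i) ℚᵘ.≃ mkℚᵘ i 0
toℚᵘ-ι i = ℚ.toℚᵘ-fromℚᵘ (mkℚᵘ i 0)

ι-+ : ∀ i j → ι (i ℤ.+ j) ≡ ι i ℚ.+ ι j
ι-+ i j = ℚ.toℚᵘ-injective (begin
  ℚ.toℚᵘ (ι (i ℤ.+ j))               ≈⟨ toℚᵘ-ι (i ℤ.+ j) ⟩
  mkℚᵘ (i ℤ.+ j) 0                   ≈⟨ *≡* (clear i j) ⟩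
  mkℚᵘ i 0 ℚᵘ.+ mkℚᵘ j 0             ≈⟨ ℚᵘ.+-cong (toℚᵘ-ι i) (toℚᵘ-ι j) ⟨
  ℚ.toℚᵘ (ι i) ℚᵘ.+ ℚ.toℚᵘ (ι j)     ≈⟨ ℚ.toℚᵘ-homo-+ (ι i) (ι j) ⟨
  ℚ.toℚᵘ (ι i ℚ.+ ι j)               ∎)
  where
  open ℚᵘ.≃-Reasoning
  clear : ∀ i j → (i ℤ.+ j) ℤ.* 1ℤ ≡ (i ℤ.* 1ℤ ℤ.+ j ℤ.* 1ℤ) ℤ.* 1ℤ
  clear = solve-∀

ι-* : ∀ i j → ι (i ℤ.* j) ≡ ι i ℚ.* ι j
ι-* i j = ℚ.toℚᵘ-injective (begin
  ℚ.toℚᵘ (ι (i ℤ.* j))               ≈⟨ toℚᵘ-ι (i ℤ.* j) ⟩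
  mkℚᵘ i 0 ℚᵘ.* mkℚᵘ j 0             ≈⟨ ℚᵘ.*-cong (toℚᵘ-ι i) (toℚᵘ-ι j) ⟨
  ℚ.toℚᵘ (ι i) ℚᵘ.* ℚ.toℚᵘ (ι j)     ≈⟨ ℚ.toℚᵘ-homo-* (ι i) (ι j) ⟨
  ℚ.toℚᵘ (ι i ℚ.* ι j)               ∎)
  where open ℚᵘ.≃-Reasoning

^ᶻ-neg-cancel : ∀ b k x .{{_ : ℤ.NonZero b}} → b ^ᶻ (ℤ.- + k) ℚ.* ι (b ℤ.^ k ℤ.* x) ≡ ι x
^ᶻ-neg-cancel b zero    x = trans (ℚ.*-identityˡ (ι (1ℤ ℤ.* x))) (cong ι (ℤ.*-identityˡ x))
-- `_^ᶻ_` inverts only at negative exponents, so the recursion runs on the powers of `b⁻¹`, where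
-- exponent 0 fits in.
^ᶻ-neg-cancel b (suc k) x = go (suc k)
  where
  open ≡-Reasoning
  open RawSemiring ℚ.+-*-rawSemiring using () renaming (_^_ to _^ℚ_)
  b⁻¹ : ℚ
  b⁻¹ = ℚ.1/_ (ι b) {{ι-nonZero b}}
  go : ∀ k → b⁻¹ ^ℚ k ℚ.* ι (b ℤ.^ k ℤ.* x) ≡ ι x
  go zero    = trans (ℚ.*-identityˡ (ι (1ℤ ℤ.* x))) (cong ι (ℤ.*-identityˡ x))
  go (suc k) = begin
    b⁻¹ ℚ.* b⁻¹ ^ℚ k ℚ.* ι (b ℤ.* b ℤ.^ k ℤ.* x)
      ≡⟨ cong₂ ℚ._*_ (ℚ.*-comm b⁻¹ (b⁻¹ ^ℚ k))
               (trans (cong ι (ℤ.*-assoc b (b ℤ.^ k) x)) (ι-* b (b ℤ.^ k ℤ.* x))) ⟩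
    b⁻¹ ^ℚ k ℚ.* b⁻¹ ℚ.* (ι b ℚ.* ι (b ℤ.^ k ℤ.* x))
      ≡⟨ ℚ.*-assoc (b⁻¹ ^ℚ k) b⁻¹ (ι b ℚ.* ι (b ℤ.^ k ℤ.* x)) ⟩
    b⁻¹ ^ℚ k ℚ.* (b⁻¹ ℚ.* (ι b ℚ.* ι (b ℤ.^ k ℤ.* x)))
      ≡⟨ cong (b⁻¹ ^ℚ k ℚ.*_) (ℚ.*-assoc b⁻¹ (ι b) (ι (b ℤ.^ k ℤ.* x))) ⟨
    b⁻¹ ^ℚ k ℚ.* (b⁻¹ ℚ.* ι b ℚ.* ι (b ℤ.^ k ℤ.* x))
      ≡⟨ cong (λ c → b⁻¹ ^ℚ k ℚ.* (c ℚ.* ι (b ℤ.^ k ℤ.* x))) (ℚ.*-inverseˡ (ι b) {{ι-nonZero b}}) ⟩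
    b⁻¹ ^ℚ k ℚ.* (1ℚ ℚ.* ι (b ℤ.^ k ℤ.* x))
      ≡⟨ cong (b⁻¹ ^ℚ k ℚ.*_) (ℚ.*-identityˡ (ι (b ℤ.^ k ℤ.* x))) ⟩
    b⁻¹ ^ℚ k ℚ.* ι (b ℤ.^ k ℤ.* x)
      ≡⟨ go k ⟩
    ι x ∎

-- `upTo` is `applyUpTo` of the identity, whose recursion composes with `suc`; hence the general
-- `g`.
foldr-filter-applyUpTo : ∀ {P : Pred ℕ 0ℓ} (P? : Decidable P) f (g : ℕ → ℕ) n →
  foldr ℤ._+_ 0ℤ (map f (filter P? (applyUpTo g n)))
    ≡ ∑ n (λ k → f (g k) ℤ.* (if does (P? (g k)) then 1ℤ else 0ℤ))
foldr-filter-applyUpTo P? f g zero    = refl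
foldr-filter-applyUpTo P? f g (suc n) with does (P? (g 0))
... | true  = cong₂ ℤ._+_ (sym (ℤ.*-identityʳ (f (g 0)))) (foldr-filter-applyUpTo P? f (g ∘ suc) n)
... | false = trans (foldr-filter-applyUpTo P? f (g ∘ suc) n)
                    (sym (trans (cong (ℤ._+ rest) (ℤ.*-zeroʳ (f (g 0)))) (ℤ.+-identityˡ rest)))
  where rest = ∑ n (λ k → f (g (suc k)) ℤ.* (if does (P? (g (suc k))) then 1ℤ else 0ℤ))

foldr-ι-applyUpTo : ∀ f (h : ℕ → ℤ) (g : ℕ → ℕ) n → (∀ k → f (g k) ≡ ι (h k)) →
  foldr ℚ._+_ 0ℚ (map f (applyUpTo g n)) ≡ ι (∑ n h)
foldr-ι-applyUpTo f h g zero    f≡ = refl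
foldr-ι-applyUpTo f h g (suc n) f≡ =
  trans (cong₂ ℚ._+_ (f≡ 0) (foldr-ι-applyUpTo f (h ∘ suc) (g ∘ suc) n (f≡ ∘ suc)))
        (sym (ι-+ (h 0) (∑ n (h ∘ suc))))

neg-^ : ∀ i n → (ℤ.- i) ℤ.^ n ≡ i ℤ.^ n ℤ.* -1ℤ ℤ.^ n
neg-^ i zero    = refl
neg-^ i (suc n) = trans (cong (ℤ.- i ℤ.*_) (neg-^ i n)) (regroup i (i ℤ.^ n) (-1ℤ ℤ.^ n))
  where
  regroup : ∀ i x y → ℤ.- i ℤ.* (x ℤ.* y) ≡ i ℤ.* x ℤ.* (-1ℤ ℤ.* y)
  regroup = solve-∀

^-cancelˡ-* : ∀ b n {x y} .{{_ : ℤ.NonZero b}} → b ℤ.^ n ℤ.* x ≡ b ℤ.^ n ℤ.* y → x ≡ y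
^-cancelˡ-* b zero    {x} {y} eq = trans (sym (ℤ.*-identityˡ x)) (trans eq (ℤ.*-identityˡ y))
^-cancelˡ-* b (suc n) {x} {y} eq =
  ^-cancelˡ-* b n (ℤ.*-cancelˡ-≡ b _ _ (trans (sym (ℤ.*-assoc b _ x)) (trans eq (ℤ.*-assoc b _ y))))

-- Fleck quotients

module Fleck (M : ℕ) (p-prime : Prime (suc M)) where

  private
    p = suc M

  open Cyclotomic M p-prime
  open Quotient (geom p X) using (act-≈; ^-homo-⊗)

  M≢0 : ℕ.NonZero M
  M≢0 = prime⇒nonZero[p∸1] {p} {{p-prime}}

  C≡act-π^-δ : ∀ n r → C[ p ] n r ≡ act (π ^ n) δ r
  C≡act-π^-δ n r = begin
    C[ p ] n r
      ≡⟨ foldr-filter-applyUpTo (λ k → + p ∣? + k ℤ.- r) (λ k → ± n C k) (λ k → k) (suc n) ⟩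
    altsum n (λ k → if does (+ p ∣? + k ℤ.- r) then 1ℤ else 0ℤ)
      ≡⟨ altsum-cong n (λ k → trans
           (cong (λ z → if does (+ p ∣? z) then 1ℤ else 0ℤ) (flip r (+ k))) (sym (act-X^ k δ r))) ⟩
    altsum n (λ k → act (X ^ k) δ r)
      ≡⟨ altsum-act n X δ r ⟩
    act (π ^ n) δ r ∎
    where
    open ≡-Reasoning
    flip : ∀ r k → k ℤ.- r ≡ ℤ.- (r ℤ.- k)
    flip = solve-∀

  -- The conditions on `s` say Q = ⌈m/M⌉, which is ⌊(m-1)/M⌋ + 1. The one surplus factor -p is that
  -- of `G₀`.
  F≡ι : ∀ m Q {s x} r → m ℕ.+ s ≡ Q ℕ.* M → s ℕ.< M →
        act (π ^ m) G₀ r ≡ (ℤ.- + p) ℤ.^ Q ℤ.* x → F[ p ] {{p-prime}} m r ≡ ι x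
  F≡ι zero (suc Q) {s} r s≡ s<M G≡ =
    contradiction (subst (M ℕ.≤_) (sym s≡) (ℕ.m≤m+n M (Q ℕ.* M))) (ℕ.<⇒≱ s<M)
  F≡ι zero zero {s} {x} r _ _ G≡ = begin
    F[ p ] {{p-prime}} 0 r
      -- ⌊-1/M⌋ = -1 with remainder M - 1, so -p occurs to the power +1 and the value is 1 - pδ,
      -- that is, `G₀`.
      ≡⟨ cong (λ e → _^ᶻ_ b {{ℕ.nonZero}} e ℚ.* ι (C[ p ] 0 r) ℚ.+ 1ℚ)
              (cong ℤ.-_ (floor-/ {n = M} { -1ℤ} {{M≢0}} M-1<M -1≡)) ⟩
    ι (b ℤ.^ 1) ℚ.* ι (C[ p ] 0 r) ℚ.+ ι 1ℤ
      ≡⟨ cong (λ c → ι (b ℤ.^ 1) ℚ.* ι c ℚ.+ ι 1ℤ) (C≡act-π^-δ 0 r) ⟩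
    ι (b ℤ.^ 1) ℚ.* ι (1ℤ ℤ.* δ r) ℚ.+ ι 1ℤ
      ≡⟨ cong (ℚ._+ ι 1ℤ) (ι-* (b ℤ.^ 1) (1ℤ ℤ.* δ r)) ⟨
    ι (b ℤ.^ 1 ℤ.* (1ℤ ℤ.* δ r)) ℚ.+ ι 1ℤ
      ≡⟨ ι-+ (b ℤ.^ 1 ℤ.* (1ℤ ℤ.* δ r)) 1ℤ ⟨
    ι (b ℤ.^ 1 ℤ.* (1ℤ ℤ.* δ r) ℤ.+ 1ℤ)
      ≡⟨ cong ι (trans (rearrange b (δ r)) (trans G≡ (ℤ.*-identityˡ x))) ⟩
    ι x ∎
    where
    open ≡-Reasoning
    b = ℤ.- + p
    M-1<M : ℕ.pred M ℕ.< M
    M-1<M = ℕ.≤-reflexive (ℕ.suc-pred M {{M≢0}})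
    cancel : ∀ m → -1ℤ ≡ m ℤ.+ -1ℤ ℤ.* (1ℤ ℤ.+ m)
    cancel = solve-∀
    -1≡ : + 0 ℤ.- 1ℤ ≡ + ℕ.pred M ℤ.+ -1ℤ ℤ.* + M
    -1≡ = trans (cancel (+ ℕ.pred M))
                (cong (λ n → + ℕ.pred M ℤ.+ -1ℤ ℤ.* + n) (ℕ.suc-pred M {{M≢0}}))
    rearrange : ∀ b d → b ℤ.* 1ℤ ℤ.* (1ℤ ℤ.* d) ℤ.+ 1ℤ ≡ 1ℤ ℤ.* (1ℤ ℤ.+ b ℤ.* d)
    rearrange = solve-∀
  F≡ι (suc m) (suc Q) {s} {x} r m+s≡ s<M G≡ = begin
    F[ p ] {{p-prime}} (suc m) r
      ≡⟨ ℚ.+-identityʳ _ ⟩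
    _^ᶻ_ b {{ℕ.nonZero}} (ℤ.- floor (_/_ (+ suc m ℤ.- 1ℤ) M {{M≢0}})) ℚ.* ι (C[ p ] (suc m) r)
      ≡⟨ cong₂ (λ e c → _^ᶻ_ b {{ℕ.nonZero}} (ℤ.- e) ℚ.* ι c)
           (floor-/ {n = M} {+ Q} {{M≢0}} (ℕ.∸-monoʳ-< {M} z<s s<M) m≡) C≡ ⟩
    _^ᶻ_ b {{ℕ.nonZero}} (ℤ.- + Q) ℚ.* ι (b ℤ.^ Q ℤ.* x)
      ≡⟨ ^ᶻ-neg-cancel b Q x {{ℕ.nonZero}} ⟩
    ι x ∎
    where
    open ≡-Reasoning
    b = ℤ.- + p
    -- If m + 1 falls short of (Q + 1) M by s, then m divided by M leaves quotient Q and remainder M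
    -- - 1 - s.
    m≡ℕ : m ≡ (M ∸ suc s) ℕ.+ Q ℕ.* M
    m≡ℕ = ℕ.+-cancelʳ-≡ (suc s) m ((M ∸ suc s) ℕ.+ Q ℕ.* M) (begin
      m ℕ.+ suc s                              ≡⟨ ℕ.+-suc m s ⟩
      suc m ℕ.+ s                              ≡⟨ m+s≡ ⟩
      M ℕ.+ Q ℕ.* M                            ≡⟨ cong (ℕ._+ Q ℕ.* M) (ℕ.m∸n+n≡m s<M) ⟨
      (M ∸ suc s) ℕ.+ suc s ℕ.+ Q ℕ.* M        ≡⟨ swap (M ∸ suc s) (suc s) (Q ℕ.* M) ⟩
      (M ∸ suc s) ℕ.+ Q ℕ.* M ℕ.+ suc s        ∎)
      where
      swap : ∀ a b c → a ℕ.+ b ℕ.+ c ≡ a ℕ.+ c ℕ.+ b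
      swap = ℕSolver.solve-∀
    m≡ : + suc m ℤ.- 1ℤ ≡ + (M ∸ suc s) ℤ.+ + Q ℤ.* + M
    m≡ = trans (cong +_ m≡ℕ) (cong (ℤ._+_ (+ (M ∸ suc s))) (ℤ.pos-* Q M))
    C≡ : C[ p ] (suc m) r ≡ b ℤ.^ Q ℤ.* x
    C≡ = ℤ.*-cancelˡ-≡ b (C[ p ] (suc m) r) (b ℤ.^ Q ℤ.* x) {{ℕ.nonZero}} (begin
      b ℤ.* C[ p ] (suc m) r             ≡⟨ cong (b ℤ.*_) (C≡act-π^-δ (suc m) r) ⟩
      b ℤ.* act (π ^ suc m) δ r          ≡⟨ cong (b ℤ.*_) (act-comm π (π ^ m) δ r) ⟩
      b ℤ.* act (π ^ m) (act π δ) r      ≡⟨ act-π^suc-G₀ m r ⟨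
      act (π ^ suc m) G₀ r               ≡⟨ G≡ ⟩
      b ℤ.* b ℤ.^ Q ℤ.* x                ≡⟨ ℤ.*-assoc b (b ℤ.^ Q) x ⟩
      b ℤ.* (b ℤ.^ Q ℤ.* x)              ∎)

  -- Adding j M to `l` raises the ceiling quotient by j and keeps the deficit `s`, while π^(jM) =
  -- (-p)^j u^j. The powers of -p therefore cancel, and one `h` serves every `k`.
  F≡ι-act-u : ∀ a l s q h r → l ℕ.+ s ≡ q ℕ.* M → s ℕ.< M →
              (∀ t → act (π ^ l) G₀ t ≡ (ℤ.- + p) ℤ.^ q ℤ.* h t) → ∀ k →
              F[ p ] {{p-prime}} (k ℕ.* p ℕ.^ a ℕ.* M ℕ.+ l) r ≡ ι (act (u X ^ (k ℕ.* p ℕ.^ a)) h r)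
  F≡ι-act-u a l s q h r l+s≡ s<M G≡ k = F≡ι (j ℕ.* M ℕ.+ l) (j ℕ.+ q) r
    (begin
      j ℕ.* M ℕ.+ l ℕ.+ s        ≡⟨ ℕ.+-assoc (j ℕ.* M) l s ⟩
      j ℕ.* M ℕ.+ (l ℕ.+ s)      ≡⟨ cong (j ℕ.* M ℕ.+_) l+s≡ ⟩
      j ℕ.* M ℕ.+ q ℕ.* M        ≡⟨ ℕ.*-distribʳ-+ M j q ⟨
      (j ℕ.+ q) ℕ.* M            ∎)
    s<M
    (begin
      act (π ^ (j ℕ.* M ℕ.+ l)) G₀ r
        ≡⟨ act-≈ (π^[M*q+t] j l) G₀∈Ker r ⟩
      b ℤ.^ j ℤ.* act (u X ^ j) (act (π ^ l) G₀) r
        ≡⟨ cong (b ℤ.^ j ℤ.*_) (trans (act-cong (u X ^ j) G≡ r) (act-* (u X ^ j) (b ℤ.^ q) h r)) ⟩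
      b ℤ.^ j ℤ.* (b ℤ.^ q ℤ.* act (u X ^ j) h r)
        ≡⟨ ℤ.*-assoc (b ℤ.^ j) (b ℤ.^ q) (act (u X ^ j) h r) ⟨
      b ℤ.^ j ℤ.* b ℤ.^ q ℤ.* act (u X ^ j) h r
        ≡⟨ cong (ℤ._* act (u X ^ j) h r) (ℤ.^-distribˡ-+-* b j q) ⟨
      b ℤ.^ (j ℕ.+ q) ℤ.* act (u X ^ j) h r ∎)
    where
    open ≡-Reasoning
    b = ℤ.- + p
    j = k ℕ.* p ℕ.^ a

  altsum-act-u-divisible : ∀ a n l q c {h} r → Ker (geom p X) h →
    (∀ t → act (π ^ l) G₀ t ≡ (ℤ.- + p) ℤ.^ q ℤ.* h t) → (q ℕ.+ c) ℕ.* M ℕ.< n ℕ.+ l ℕ.+ M →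
    ∃ λ z → altsum n (λ k → act (u X ^ (k ℕ.* p ℕ.^ a)) h r) ≡ (+ p) ℤ.^ (a ℕ.* n ℕ.+ c) ℤ.* z
  altsum-act-u-divisible a n l q c {h} r h∈Ker G≡ qM+cM<
    with altsum-act-u a n | act-π^-G₀ (q ℕ.+ c) (n ℕ.+ l) qM+cM<
  -- `π` yields powers of -p and the modulus is a power of p; the sign goes into the cofactor.
  ... | W , altsum≡ | h′ , _ , G′≡ = -1ℤ ℤ.^ c ℤ.* act W h′ r , (begin
    altsum n (λ k → act (u X ^ (k ℕ.* p ℕ.^ a)) h r)
      ≡⟨ altsum≡ h∈Ker r ⟩
    (+ p) ℤ.^ (a ℕ.* n) ℤ.* act W (act (π ^ n) h) r
      ≡⟨ cong ((+ p) ℤ.^ (a ℕ.* n) ℤ.*_) (trans (act-cong W π^n-h≡ r) (act-* W (b ℤ.^ c) h′ r)) ⟩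
    (+ p) ℤ.^ (a ℕ.* n) ℤ.* (b ℤ.^ c ℤ.* act W h′ r)
      ≡⟨ cong (λ y → (+ p) ℤ.^ (a ℕ.* n) ℤ.* (y ℤ.* act W h′ r)) (neg-^ (+ p) c) ⟩
    (+ p) ℤ.^ (a ℕ.* n) ℤ.* ((+ p) ℤ.^ c ℤ.* -1ℤ ℤ.^ c ℤ.* act W h′ r)
      ≡⟨ regroup ((+ p) ℤ.^ (a ℕ.* n)) ((+ p) ℤ.^ c) (-1ℤ ℤ.^ c) (act W h′ r) ⟩
    (+ p) ℤ.^ (a ℕ.* n) ℤ.* (+ p) ℤ.^ c ℤ.* (-1ℤ ℤ.^ c ℤ.* act W h′ r)
      ≡⟨ cong (ℤ._* (-1ℤ ℤ.^ c ℤ.* act W h′ r)) (ℤ.^-distribˡ-+-* (+ p) (a ℕ.* n) c) ⟨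
    (+ p) ℤ.^ (a ℕ.* n ℕ.+ c) ℤ.* (-1ℤ ℤ.^ c ℤ.* act W h′ r) ∎)
    where
    open ≡-Reasoning
    b = ℤ.- + p
    regroup : ∀ x y s z → x ℤ.* (y ℤ.* s ℤ.* z) ≡ x ℤ.* y ℤ.* (s ℤ.* z)
    regroup = solve-∀
    π^n-h≡ : ∀ t → act (π ^ n) h t ≡ b ℤ.^ c ℤ.* h′ t
    -- `h` is known only through b^q h, so the two sides are compared after multiplication by b^q.
    π^n-h≡ t = ^-cancelˡ-* b q {{ℕ.nonZero}} (begin
      b ℤ.^ q ℤ.* act (π ^ n) h t
        ≡⟨ act-* (π ^ n) (b ℤ.^ q) h t ⟨
      act (π ^ n) (λ s → b ℤ.^ q ℤ.* h s) t
        ≡⟨ act-cong (π ^ n) G≡ t ⟨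
      act (π ^ n) (act (π ^ l) G₀) t
        ≡⟨ act-≈ (^-homo-⊗ π n l) G₀∈Ker t ⟨
      act (π ^ (n ℕ.+ l)) G₀ t
        ≡⟨ G′≡ t ⟩
      b ℤ.^ (q ℕ.+ c) ℤ.* h′ t
        ≡⟨ cong (ℤ._* h′ t) (ℤ.^-distribˡ-+-* b q c) ⟩
      b ℤ.^ q ℤ.* b ℤ.^ c ℤ.* h′ t
        ≡⟨ ℤ.*-assoc (b ℤ.^ q) (b ℤ.^ c) (h′ t) ⟩
      b ℤ.^ q ℤ.* (b ℤ.^ c ℤ.* h′ t) ∎)

  sum-divisible : ∀ a l n r s q c → l ℕ.+ s ≡ q ℕ.* M → s ℕ.< M → (q ℕ.+ c) ℕ.* M ℕ.< n ℕ.+ l ℕ.+ M →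
    ∃ λ z → sum-upTo n (λ k → ι (± n C k) ℚ.* F[ p ] {{p-prime}} (k ℕ.* p ℕ.^ a ℕ.* M ℕ.+ l) r)
            ≡ ι ((+ p) ℤ.^ (a ℕ.* n ℕ.+ c)) ℚ.* ι z
  sum-divisible a l n r s q c l+s≡ s<M bound
    with act-π^-G₀ q l (subst (ℕ._< l ℕ.+ M) l+s≡ (ℕ.+-monoʳ-< l s<M))
  ... | h , h∈Ker , G≡ with altsum-act-u-divisible a n l q c r h∈Ker G≡ bound
  ... | z , altsum≡ = z , (begin
    sum-upTo n summand
      ≡⟨ foldr-ι-applyUpTo summand (λ k → ± n C k ℤ.* value k) (λ k → k) (suc n)
           (λ k → trans (cong (ι (± n C k) ℚ.*_) (F≡ι-act-u a l s q h r l+s≡ s<M G≡ k))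
                        (sym (ι-* (± n C k) (value k)))) ⟩
    ι (altsum n value)
      ≡⟨ cong ι altsum≡ ⟩
    ι ((+ p) ℤ.^ (a ℕ.* n ℕ.+ c) ℤ.* z)
      ≡⟨ ι-* ((+ p) ℤ.^ (a ℕ.* n ℕ.+ c)) z ⟩
    ι ((+ p) ℤ.^ (a ℕ.* n ℕ.+ c)) ℚ.* ι z ∎)
    where
    open ≡-Reasoning
    summand : ℕ → ℚ
    summand k = ι (± n C k) ℚ.* F[ p ] {{p-prime}} (k ℕ.* p ℕ.^ a ℕ.* M ℕ.+ l) r
    value : ℕ → ℤ
    value k = act (u X ^ (k ℕ.* p ℕ.^ a)) h r

-- The residue and the ceiling in the modulus

-- The residue of -l is what `l` lacks to the next multiple of `n`, so the witness is ⌈l/n⌉.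
-‿%ℕ : ∀ l n .{{_ : ℕ.NonZero n}} → ∃ λ q → l ℕ.+ (ℤ.- + l) %ℕ n ≡ q ℕ.* n
-‿%ℕ l n = ℕ.quotient n∣ , ℕ.m∣n⇒n≡quotient*m n∣
  where
  s = (ℤ.- + l) %ℕ n
  z = (ℤ.- + l) /ℕ n
  move : ∀ l s zn → ℤ.- l ≡ s ℤ.+ zn → l ℤ.+ s ≡ ℤ.- zn
  move l s zn eq = trans (rearrange l s zn)
    (trans (cong (λ x → ℤ.- x ℤ.+ (s ℤ.+ zn) ℤ.- zn) eq) (cancel (s ℤ.+ zn) zn))
    where
    rearrange : ∀ l s zn → l ℤ.+ s ≡ ℤ.- (ℤ.- l) ℤ.+ (s ℤ.+ zn) ℤ.- zn
    rearrange = solve-∀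
    cancel : ∀ x zn → ℤ.- x ℤ.+ x ℤ.- zn ≡ ℤ.- zn
    cancel = solve-∀
  n∣ : n ∣ l ℕ.+ s
  n∣ = ℤ.∣⇒∣ᵤ {+ n} {+ (l ℕ.+ s)} (ℤ.divides (ℤ.- z)
    (trans (move (+ l) (+ s) (z ℤ.* + n) (a≡a%ℕn+[a/ℕn]*n (ℤ.- + l) n)) (ℤ.neg-distribˡ-* z (+ n))))

-- ⌈(n-s)/M⌉ = ⌊(n-s+M-1)/M⌋, and since s < M the last numerator is the natural number n + (M-1-s).
-- So the ceiling is nonnegative even when n < s.
ceiling-quotient : ∀ n s M .{{_ : ℕ.NonZero M}} → s ℕ.< M →
  ∃ λ c → ceiling ((+ n ℤ.- + s) / M) ≡ + c × c ℕ.* M ℕ.+ s ℕ.< n ℕ.+ M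
ceiling-quotient n s M s<M = c , ceiling≡ , bound
  where
  t = M ∸ suc s
  c = (n ℕ.+ t) ℕ./ M
  ρ = (n ℕ.+ t) ℕ.% M
  ρ<M : ρ ℕ.< M
  ρ<M = ℕ.m%n<n (n ℕ.+ t) M
  n+t≡ : n ℕ.+ t ≡ ρ ℕ.+ c ℕ.* M
  n+t≡ = ℕ.m≡m%n+[m/n]*n (n ℕ.+ t) M

  bound : c ℕ.* M ℕ.+ s ℕ.< n ℕ.+ M
  bound = begin-strict
    c ℕ.* M ℕ.+ s          ≤⟨ ℕ.+-monoˡ-≤ s (ℕ.m≤n+m (c ℕ.* M) ρ) ⟩
    ρ ℕ.+ c ℕ.* M ℕ.+ s    ≡⟨ cong (ℕ._+ s) n+t≡ ⟨
    n ℕ.+ t ℕ.+ s          ≡⟨ ℕ.+-assoc n t s ⟩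
    n ℕ.+ (t ℕ.+ s)        <⟨ ℕ.+-monoʳ-< n (ℕ.≤-reflexive (trans (sym (ℕ.+-suc t s)) (ℕ.m∸n+n≡m s<M))) ⟩
    n ℕ.+ M                ∎
    where open ℕ.≤-Reasoning

  cancel : ∀ x y → x ℤ.+ y ℤ.- x ≡ y
  cancel = solve-∀
  toρ : ∀ n s ρ′ ρ → n ℤ.- s ℤ.+ ρ′ ≡ n ℤ.- s ℤ.- 1ℤ ℤ.- ρ ℤ.+ (1ℤ ℤ.+ ρ ℤ.+ ρ′)
  toρ = solve-∀
  fromρ : ∀ n s t ρ → n ℤ.- s ℤ.- 1ℤ ℤ.- ρ ℤ.+ (1ℤ ℤ.+ s ℤ.+ t) ≡ n ℤ.+ t ℤ.- ρ
  fromρ = solve-∀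
  ceiling≡ : ceiling ((+ n ℤ.- + s) / M) ≡ + c
  -- If n + t leaves remainder ρ, then n - s falls short of c M by M - 1 - ρ.
  ceiling≡ = ceiling-/ {+ n ℤ.- + s} {M} {+ c} (ℕ.∸-monoʳ-< {M} z<s ρ<M) (begin
    + n ℤ.- + s ℤ.+ + (M ∸ suc ρ)
      ≡⟨ toρ (+ n) (+ s) (+ (M ∸ suc ρ)) (+ ρ) ⟩
    + n ℤ.- + s ℤ.- 1ℤ ℤ.- + ρ ℤ.+ + (suc ρ ℕ.+ (M ∸ suc ρ))
      ≡⟨ cong (λ x → + n ℤ.- + s ℤ.- 1ℤ ℤ.- + ρ ℤ.+ + x) (trans (ℕ.m+[n∸m]≡n ρ<M) (sym (ℕ.m+[n∸m]≡n s<M))) ⟩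
    + n ℤ.- + s ℤ.- 1ℤ ℤ.- + ρ ℤ.+ + (suc s ℕ.+ t)
      ≡⟨ fromρ (+ n) (+ s) (+ t) (+ ρ) ⟩
    + (n ℕ.+ t) ℤ.- + ρ
      ≡⟨ cong (λ x → + x ℤ.- + ρ) n+t≡ ⟩
    + ρ ℤ.+ + (c ℕ.* M) ℤ.- + ρ
      ≡⟨ cancel (+ ρ) (+ (c ℕ.* M)) ⟩
    + (c ℕ.* M)
      ≡⟨ ℤ.pos-* c M ⟩
    + c ℤ.* + M ∎)
    where open ≡-Reasoning

theorem1p3 :
    (p : ℕ) {{p-prime : Prime p}} (a l n : ℕ) (r : ℤ) →
    let l* = (ℤ.- (+ l)) %ℕ (p ∸ 1)
        e  = + (a ℕ.* n) ℤ.+ ⌈ (+ n ℤ.- + l*) / (p ∸ 1) ⌉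
    in
    (Σ[ k ≤ n ] (ι (+ (n C k) ℤ.* -1ℤ ℤ.^ k)
                  ℚ.* F[ p ] (k ℕ.* p ℕ.^ a ℕ.* (p ∸ 1) ℕ.+ l) r))
      ≡ 0ℚ ⟨mod _^ᶻ_ (+ p) {{prime⇒nonZero p-prime}} e ⟩
theorem1p3 zero    {{p-prime}} a l n r = contradiction p-prime ¬prime[0]
theorem1p3 (suc M) {{p-prime}} a l n r =
  let q , l+l*≡ = -‿%ℕ l M
      c , ceiling≡ , c*M+l*< = ceiling-quotient n l* M l*<M
      z , sum≡ = Fleck.sum-divisible M p-prime a l n r l* q c l+l*≡ l*<M (bound q c l+l*≡ c*M+l*<)
  in z , trans (ℚ.+-identityʳ _)
           -- With the ceiling equal to `+ c`, the exponent computes to `+ (a ℕ.* n ℕ.+ c)` and the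
           -- power is that of an integer.
           (trans sum≡ (cong (λ e → _^ᶻ_ (+ suc M) {{ℕ.nonZero}} (+ (a ℕ.* n) ℤ.+ e) ℚ.* ι z) (sym ceiling≡)))
  where
  instance
    M≢0 : ℕ.NonZero M
    M≢0 = prime⇒nonZero[p∸1] {suc M} {{p-prime}}
  l* : ℕ
  l* = (ℤ.- (+ l)) %ℕ M
  l*<M : l* ℕ.< M
  l*<M = n%ℕd<d (ℤ.- (+ l)) M
  swap : ∀ n M l → n ℕ.+ M ℕ.+ l ≡ n ℕ.+ l ℕ.+ M
  swap = ℕSolver.solve-∀
  regroup : ∀ x y l → l ℕ.+ x ℕ.+ y ≡ y ℕ.+ x ℕ.+ l
  regroup = ℕSolver.solve-∀
  -- Adding q M = l + l* absorbs the `l*` in the bound on `c`, leaving q + c ≤ ⌈(n+l)/M⌉.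
  bound : ∀ q c → l ℕ.+ l* ≡ q ℕ.* M → c ℕ.* M ℕ.+ l* ℕ.< n ℕ.+ M → (q ℕ.+ c) ℕ.* M ℕ.< n ℕ.+ l ℕ.+ M
  bound q c l+l*≡ c*M+l*< = begin-strict
    (q ℕ.+ c) ℕ.* M            ≡⟨ ℕ.*-distribʳ-+ M q c ⟩
    q ℕ.* M ℕ.+ c ℕ.* M        ≡⟨ cong (ℕ._+ c ℕ.* M) l+l*≡ ⟨
    l ℕ.+ l* ℕ.+ c ℕ.* M       ≡⟨ regroup l* (c ℕ.* M) l ⟩
    c ℕ.* M ℕ.+ l* ℕ.+ l       <⟨ ℕ.+-monoˡ-< l c*M+l*< ⟩
    n ℕ.+ M ℕ.+ l              ≡⟨ swap n M l ⟩
    n ℕ.+ l ℕ.+ M              ∎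
    where open ℕ.≤-Reasoning
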